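{- Let $A$ and $B$ be real diagonal $d\times d$ matrices, and let $P,S$ be independent uniformly random $d\times d$ signed permutation matrices. Then \[ \mathbb{E}_{P,S}\det\!\big(xI-(A+PBS^T)(A+PBS^T)^T\big)=\sum_{k=0}^{d}x^{d-k}(-1)^k\sum_{i+j=k}\left(\frac{(d-i)!\,(d-j)!}{(d-k)!\,d!}\right)^2 e_i(AA^T)\,e_j(BB^T). \]
   Context: A signed permutation matrix is a matrix with entries in $\{0,\pm1\}$ having exactly one nonzero entry in each row and each column; a uniform random one is the product of a diagonal matrix with independent uniform $\pm1$ entries and a uniformly random permutation matrix. For a $d\times d$ matrix $M$, $e_k(M)$ is the sum of its $k\times k$ principal minors (the coefficient of $(-1)^kx^{d-k}$ in $\det(xI-M)$). -}

module Defs where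

open import Level using (Level; _⊔_)
open import Algebra.Bundles using (CommutativeRing)
open import Data.Nat as ℕ using (ℕ; zero; suc; _∸_; _!)
open import Data.Fin as Fin using (Fin; zero; suc; punchIn; toℕ)
open import Data.Fin.Properties using (any?; all?) renaming (_≟_ to _≟ᶠ_)
open import Data.Bool using (Bool; true; false; if_then_else_; _∧_; _∨_; not)
open import Data.List as List using (List; []; _∷_; allFin; concatMap; filterᵇ; foldr; length)
import Data.Vec.Functional as V
open import Relation.Binary.PropositionalEquality using (_≢_)
open import Relation.Nullary.Decidable using (does; ⌊_⌋)

-- Scalars: a commutative ring in which every nonzero natural number is
-- invertible (a ℚ-algebra).  ℝ is an instance; agda-stdlib has no reals.

ιᴿ : ∀ {c ℓ} (R : CommutativeRing c ℓ) → ℕ → CommutativeRing.Carrier R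
ιᴿ R zero    = CommutativeRing.0# R
ιᴿ R (suc n) = CommutativeRing._+_ R (CommutativeRing.1# R) (ιᴿ R n)

record QAlgebra (c ℓ : Level) : Set (Level.suc (c ⊔ ℓ)) where
  field
    commRing : CommutativeRing c ℓ
  open CommutativeRing commRing public
  ι : ℕ → Carrier
  ι = ιᴿ commRing
  field
    recip   : ℕ → Carrier            -- 1/n (value at 0 irrelevant)
    recip-inverse : ∀ n → n ≢ 0 → ι n * recip n ≈ 1#

module _ {c ℓ} (Q : QAlgebra c ℓ) where
  open QAlgebra Q using (Carrier; _≈_; _+_; _*_; -_; _-_; 0#; 1#; ι; recip)

  sumL : List Carrier → Carrier
  sumL = foldr _+_ 0#

  Σᶠ : ∀ {n} → (Fin n → Carrier) → Carrier
  Σᶠ {n} f = sumL (List.map f (allFin n))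

  Σ≤ : ℕ → (ℕ → Carrier) → Carrier
  Σ≤ zero    f = f 0
  Σ≤ (suc n) f = Σ≤ n f + f (suc n)

  _^_ : Carrier → ℕ → Carrier
  x ^ zero  = 1#
  x ^ suc n = x * (x ^ n)

  𝔼 : ∀ {a} {A : Set a} → List A → (A → Carrier) → Carrier
  𝔼 xs f = recip (length xs) * sumL (List.map f xs)

  Mat : ℕ → Set c
  Mat d = Fin d → Fin d → Carrier

  I : ∀ {d} → Mat d
  I i j = if ⌊ i ≟ᶠ j ⌋ then 1# else 0#

  diag : ∀ {d} → (Fin d → Carrier) → Mat d
  diag a i j = if ⌊ i ≟ᶠ j ⌋ then a i else 0#

  _⊕_ _⊖_ _⊗_ : ∀ {d} → Mat d → Mat d → Mat d
  (M ⊕ N) i j = M i j + N i j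
  (M ⊖ N) i j = M i j - N i j
  (M ⊗ N) i j = Σᶠ (λ k → M i k * N k j)

  _ᵀ : ∀ {d} → Mat d → Mat d
  (M ᵀ) i j = M j i

  _·_ : ∀ {d} → Carrier → Mat d → Mat d
  (x · M) i j = x * M i j

  det : ∀ {d} → Mat d → Carrier
  det {zero}  M = 1#
  det {suc d} M = Σᶠ λ j →
    ((- 1#) ^ toℕ j) * (M zero j * det (λ a b → M (suc a) (punchIn j b)))

  -- e_k(M): sum of the k × k principal minors, indexed by strictly
  -- increasing maps Fin k → Fin d (i.e. k-element subsets of Fin d)
  allFuns : (m n : ℕ) → List (Fin m → Fin n)
  allFuns zero    n = (λ ()) ∷ []
  allFuns (suc m) n = concatMap (λ f → List.map (λ k → k V.∷ f) (allFin n)) (allFuns m n)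

  allᵇ : ∀ {n} → (Fin n → Bool) → Bool
  allᵇ {n} p = foldr _∧_ true (List.map p (allFin n))

  increasing : ∀ {k d} → (Fin k → Fin d) → Bool
  increasing ι' = allᵇ λ a → allᵇ λ b →
    not (⌊ toℕ a ℕ.<? toℕ b ⌋) ∨ ⌊ toℕ (ι' a) ℕ.<? toℕ (ι' b) ⌋

  e : ∀ {d} → ℕ → Mat d → Carrier
  e {d} k M = sumL (List.map (λ ι' → det (λ a b → M (ι' a) (ι' b)))
                             (filterᵇ increasing (allFuns k d)))

  -- uniformly random signed permutation matrices: all pairs (s, σ)
  -- with s : Fin d → {±1} and σ a permutation (injective self-map) of Fin d;
  -- the matrix is D_s Π_σ, with entry (i,j) = s i if σ i = j, else 0.
  injective : ∀ {d} → (Fin d → Fin d) → Bool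
  injective σ = allᵇ λ i → allᵇ λ j → not ⌊ σ i ≟ᶠ σ j ⌋ ∨ ⌊ i ≟ᶠ j ⌋

  sgn : Fin 2 → Carrier
  sgn zero       = 1#
  sgn (suc zero) = - 1#

  signedPerms : (d : ℕ) → List (Mat d)
  signedPerms d =
    concatMap (λ s → List.map (λ σ i j → if ⌊ σ i ≟ᶠ j ⌋ then sgn (s i) else 0#)
                              (filterᵇ injective (allFuns d d)))
              (allFuns d 2)

  LHS : (d : ℕ) → (a b : Fin d → Carrier) → Carrier → Carrier
  LHS d a b x =
    𝔼 (signedPerms d) λ P → 𝔼 (signedPerms d) λ S →
      let M = diag a ⊕ (P ⊗ (diag b ⊗ (S ᵀ))) in
      det ((x · I) ⊖ (M ⊗ (M ᵀ)))

  coeff : ℕ → ℕ → ℕ → ℕ → Carrier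
  coeff d i j k =
    let q = ι (((d ∸ i) !) ℕ.* ((d ∸ j) !)) * recip (((d ∸ k) !) ℕ.* (d !)) in q * q

  RHS : (d : ℕ) → (a b : Fin d → Carrier) → Carrier → Carrier
  RHS d a b x =
    let A = diag a ; B = diag b in
    Σ≤ d λ k → (x ^ (d ∸ k)) * (((- 1#) ^ k) *
      Σ≤ k λ i → coeff d i (k ∸ i) k * (e i (A ⊗ (A ᵀ)) * e (k ∸ i) (B ⊗ (B ᵀ))))

{-# OPTIONS --safe #-}

-- Write P = D_s Π_σ and S = D_t Π_τ.  Up to signing and relabelling columns, row i
-- of A + P B Sᵀ is supported on the labels τ i (entry ± a i) and σ i (entry ± b (σ i)).
-- Expanding det (x I - M Mᵀ) along the first row and averaging over its sign kills
-- the cross terms, and the matrix determinant lemma absorbs the rest into deleting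
-- a column.  Hence the average over s is the matching polynomial: the sum over
-- disjoint sets U, V of rows with τ(U) ∩ σ(V) = ∅ of
--   (-1)^(|U|+|V|) x^(d-|U|-|V|) ∏_{i ∈ U} (a i)² ∏_{i ∈ V} (b (σ i))².
-- Summing over τ for fixed σ, U, V only counts; summing over σ symmetrises b²;
-- the sum over V, U then gives binomial coefficients times elementary symmetric functions.

module Submission where

open import Defs
open import Level using (Level)
open import Algebra.Bundles using (CommutativeRing; RawRing)
import Algebra.Solver.Ring as RingSolver
open import Algebra.Solver.Ring.AlmostCommutativeRing using (_-Raw-AlmostCommutative⟶_; fromCommutativeRing)
open import Data.Bool using (Bool; true; false; if_then_else_; not; _∧_; _∨_)
open import Data.Bool.Properties using (T-≡)
open import Data.Fin using (Fin; zero; suc; punchIn; punchOut; pinch; toℕ)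
open import Data.Fin.Properties using (punchInᵢ≢i; punchIn-injective; punchIn-punchOut; toℕ-injective; 0≢1+n; suc-injective) renaming (_≟_ to _≟ᶠ_)
open import Data.List as List using (List; []; _∷_)
import Data.List.Properties as Listₚ
open import Data.Maybe using (Maybe; just; nothing)
open import Data.Nat as ℕ using (ℕ; zero; suc; _!; _∸_; _≤_; _<_; _<ᵇ_)
open import Data.Nat.Combinatorics using (_C_; nCk+nC[k+1]≡[n+1]C[k+1]; k>n⇒nCk≡0; nCk≡n!/k![n-k]!; k![n∸k]!∣n!)
open import Data.Nat.DivMod using (m/n*n≡m)
open import Data.Nat.Properties using (_!≢0; _!*_!≢0)
import Data.Nat.Properties as ℕₚ
import Data.Nat.Tactic.RingSolver as ℕ-Solver
open import Data.Product using (_×_; _,_; ∃; proj₁; proj₂)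
open import Data.Vec as Vec using (Vec; []; _∷_; lookup)
import Data.Vec.Functional as V
open import Data.Vec.Properties using (lookup-map)
open import Function using (_∘_; id)
open import Function.Bundles using (Equivalence)
open import Relation.Binary.Definitions using (tri<; tri≈; tri>)
open import Relation.Binary.PropositionalEquality as ≡ using (_≡_; _≢_)
open import Relation.Nullary using (Dec; contradiction)
open import Relation.Nullary.Decidable using (⌊_⌋; yes; no)

-- The scalars form a commutative ring, where `K` has no inverse; so the matrix determinant lemma is
-- phrased with bordered determinants, which obey a first-row expansion of their own. Deleting a
-- column would change the index set at every step; instead the columns carry weights `χ`, a
-- deletion multiplies `χ` by an indicator, and the recursion is an identity in arbitrary weights.
-- It is the recursion that removes one row from the matchings of the bipartite multigraph joining
-- row i to the labels τ i and σ i, in the spirit of Godsil and Gutman on random signings. The signs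
-- of S leave no trace: a column sign does not change M Mᵀ, so they move to the entries a i, which
-- survive only as squares. The square in the coefficient has its origin in two counts. With i + j =
-- k, the choice of V outside U gives C(d-i, j), the choice of τ(U) outside σ(V) gives C(d-j, i).
-- Times j! and i! these are (d-i)!/(d-k)! and (d-j)!/(d-k)!. The completions of τ outside U and of
-- σ outside V contribute (d-i)! and (d-j)! once more, and the two averages divide by d! twice.

≟-suc : ∀ {n} (i j : Fin n) → ⌊ suc i ≟ᶠ suc j ⌋ ≡ ⌊ i ≟ᶠ j ⌋
≟-suc i j with i ≟ᶠ j
... | yes _ = ≡.refl
... | no  _ = ≡.refl

-- A pair (`j`, `k`) encodes two different columns, `j` and `punchIn j k`. Once column `punchIn j k`
-- is removed, `j` sits at position `pinch k j`; so (`punchIn j k`, `pinch k j`) encodes the same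
-- two columns in the opposite order.
punchIn-pinch : ∀ {n} (j : Fin (suc n)) k → punchIn (punchIn j k) (pinch k j) ≡ j
punchIn-pinch zero    zero    = ≡.refl
punchIn-pinch zero    (suc k) = ≡.refl
punchIn-pinch (suc j) zero    = ≡.refl
punchIn-pinch (suc j) (suc k) = ≡.cong suc (punchIn-pinch j k)

-- Removing two columns in either order leaves the same columns in the same places, so the doubly
-- reduced minors agree.
punchIn-punchIn-pinch : ∀ {n} (j : Fin (suc (suc n))) k m →
  punchIn (punchIn j k) (punchIn (pinch k j) m) ≡ punchIn j (punchIn k m)
punchIn-punchIn-pinch zero    zero    m       = ≡.refl
punchIn-punchIn-pinch zero    (suc k) m       = ≡.refl
punchIn-punchIn-pinch (suc j) zero    m       = ≡.refl
punchIn-punchIn-pinch (suc j) (suc k) zero    = ≡.refl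
punchIn-punchIn-pinch {suc n} (suc j) (suc k) (suc m) = ≡.cong suc (punchIn-punchIn-pinch j k m)

≡-from-⇔ : ∀ {a b} → (a ≡ true → b ≡ true) → (b ≡ true → a ≡ true) → a ≡ b
≡-from-⇔ {true}  {b}     h k = ≡.sym (h ≡.refl)
≡-from-⇔ {false} {true}  h k = k ≡.refl
≡-from-⇔ {false} {false} h k = ≡.refl

∧-true : ∀ {a b} → a ∧ b ≡ true → a ≡ true × b ≡ true
∧-true {true} {true} _ = ≡.refl , ≡.refl

∧-intro : ∀ {a b} → a ≡ true → b ≡ true → a ∧ b ≡ true
∧-intro ≡.refl ≡.refl = ≡.refl

≟-refl : ∀ {n} (k : Fin n) → ⌊ k ≟ᶠ k ⌋ ≡ true
≟-refl k with k ≟ᶠ k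
... | yes _ = ≡.refl
... | no ¬p = contradiction ≡.refl ¬p

≟-≢ : ∀ {n} {k l : Fin n} → k ≢ l → ⌊ k ≟ᶠ l ⌋ ≡ false
≟-≢ {k = k} {l} k≢l with k ≟ᶠ l
... | yes p = contradiction p k≢l
... | no _  = ≡.refl

≟-inj : ∀ {m n} (f : Fin m → Fin n) → (∀ {k l} → f k ≡ f l → k ≡ l) → ∀ k l → ⌊ f k ≟ᶠ f l ⌋ ≡ ⌊ k ≟ᶠ l ⌋
≟-inj f inj k l with k ≟ᶠ l
... | yes ≡.refl = ≟-refl (f k)
... | no k≢l     = ≟-≢ (k≢l ∘ inj)

-- Vectors without repetition

fresh : ∀ {m n} → Fin n → Vec (Fin n) m → Bool
fresh k []      = true
fresh k (l ∷ v) = not ⌊ k ≟ᶠ l ⌋ ∧ fresh k v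

-- Permutations are represented by vectors that pass this test: sums over them can recurse on the
-- first entry, and no extensionality of functions enters the inductions.
distinct : ∀ {m n} → Vec (Fin n) m → Bool
distinct []      = true
distinct (k ∷ v) = fresh k v ∧ distinct v

fresh-punchIn : ∀ {m n} k l (v : Vec (Fin n) m) → fresh (punchIn k l) (Vec.map (punchIn k) v) ≡ fresh l v
fresh-punchIn k l []      = ≡.refl
fresh-punchIn k l (h ∷ v) = ≡.cong₂ (λ a b → not a ∧ b) (≟-inj (punchIn k) (punchIn-injective k _ _) l h) (fresh-punchIn k l v)

distinct-punchIn : ∀ {m n} k (v : Vec (Fin n) m) → distinct (Vec.map (punchIn k) v) ≡ distinct v
distinct-punchIn k []      = ≡.refl
distinct-punchIn k (l ∷ v) = ≡.cong₂ _∧_ (fresh-punchIn k l v) (distinct-punchIn k v)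

implies-elim : ∀ {a b} {A : Set a} {B : Set b} (A? : Dec A) (B? : Dec B) → not ⌊ A? ⌋ ∨ ⌊ B? ⌋ ≡ true → A → B
implies-elim (yes _) (yes b) h a = b
implies-elim (no ¬a) B?      h a = contradiction a ¬a

implies-intro : ∀ {a b} {A : Set a} {B : Set b} (A? : Dec A) (B? : Dec B) → (A → B) → not ⌊ A? ⌋ ∨ ⌊ B? ⌋ ≡ true
implies-intro (yes a) (yes b) h = ≡.refl
implies-intro (yes a) (no ¬b) h = contradiction (h a) ¬b
implies-intro (no ¬a) B?      h = ≡.refl

Injective : ∀ {m n} → (Fin m → Fin n) → Set
Injective f = ∀ {i j} → f i ≡ f j → i ≡ j

fresh-elim : ∀ {m n} {k : Fin n} (v : Vec (Fin n) m) → fresh k v ≡ true → ∀ i → k ≢ lookup v i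
fresh-elim {k = k} (l ∷ v) h zero    with k ≟ᶠ l
... | no k≢l = k≢l
fresh-elim {k = k} (l ∷ v) h (suc i) = fresh-elim v (proj₂ (∧-true {a = not ⌊ k ≟ᶠ l ⌋} h)) i

fresh-intro : ∀ {m n} {k : Fin n} (v : Vec (Fin n) m) → (∀ i → k ≢ lookup v i) → fresh k v ≡ true
fresh-intro         []      h = ≡.refl
fresh-intro {k = k} (l ∷ v) h = ∧-intro (≡.cong not (≟-≢ (h zero))) (fresh-intro v (h ∘ suc))

distinct-elim : ∀ {m n} (v : Vec (Fin n) m) → distinct v ≡ true → Injective (lookup v)
distinct-elim (k ∷ v) h {zero}  {zero}  e = ≡.refl
distinct-elim (k ∷ v) h {zero}  {suc j} e = contradiction e (fresh-elim v (proj₁ (∧-true h)) j)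
distinct-elim (k ∷ v) h {suc i} {zero}  e = contradiction (≡.sym e) (fresh-elim v (proj₁ (∧-true h)) i)
distinct-elim (k ∷ v) h {suc i} {suc j} e = ≡.cong suc (distinct-elim v (proj₂ (∧-true {a = fresh k v} h)) e)

distinct-intro : ∀ {m n} (v : Vec (Fin n) m) → Injective (lookup v) → distinct v ≡ true
distinct-intro []      h = ≡.refl
distinct-intro (k ∷ v) h = ∧-intro (fresh-intro v λ i e → 0≢1+n (h {zero} {suc i} e)) (distinct-intro v (suc-injective ∘ h))

-- Every label other than `k` has a preimage under `punchIn k`. This shrinks the label set by one
-- and so permits induction on permutations.
unpunch : ∀ {m n} (k : Fin (suc n)) (v : Vec (Fin (suc n)) m) → fresh k v ≡ true → ∃ λ w → v ≡ Vec.map (punchIn k) w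
unpunch k []      h = [] , ≡.refl
unpunch k (l ∷ v) h = let w , eq = unpunch k v (proj₂ (∧-true {a = not ⌊ k ≟ᶠ l ⌋} h)) ; k≢l = fresh-elim (l ∷ v) h zero in
  punchOut k≢l ∷ w , ≡.cong₂ _∷_ (≡.sym (punchIn-punchOut k≢l)) eq

-- Increasing index maps

Ascending : ∀ {m n} → (Fin m → Fin n) → Set
Ascending f = ∀ i j → toℕ i < toℕ j → toℕ (f i) < toℕ (f j)

ascending⇒injective : ∀ {m n} {f : Fin m → Fin n} → Ascending f → Injective f
ascending⇒injective {f = f} h {i} {j} e with ℕₚ.<-cmp (toℕ i) (toℕ j)
... | tri< i<j _ _ = contradiction (≡.cong toℕ e) (ℕₚ.<⇒≢ (h i j i<j))
... | tri≈ _ i≡j _ = toℕ-injective i≡j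
... | tri> _ _ j<i = contradiction (≡.cong toℕ (≡.sym e)) (ℕₚ.<⇒≢ (h j i j<i))

below : ∀ {m n} → Fin n → Vec (Fin n) m → Bool
below k []      = true
below k (l ∷ v) = (toℕ k <ᵇ toℕ l) ∧ below k v

ascending : ∀ {m n} → Vec (Fin n) m → Bool
ascending []      = true
ascending (k ∷ v) = below k v ∧ ascending v

<ᵇ-elim : ∀ m n → (m <ᵇ n) ≡ true → m < n
<ᵇ-elim m n h = ℕₚ.<ᵇ⇒< m n (Equivalence.from T-≡ h)

<ᵇ-intro : ∀ {m n} → m < n → (m <ᵇ n) ≡ true
<ᵇ-intro m<n = Equivalence.to T-≡ (ℕₚ.<⇒<ᵇ m<n)

below-elim : ∀ {m n} {k : Fin n} (v : Vec (Fin n) m) → below k v ≡ true → ∀ i → toℕ k < toℕ (lookup v i)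
below-elim {k = k} (l ∷ v) h zero    = <ᵇ-elim (toℕ k) (toℕ l) (proj₁ (∧-true h))
below-elim {k = k} (l ∷ v) h (suc i) = below-elim v (proj₂ (∧-true {a = toℕ k <ᵇ toℕ l} h)) i

below-intro : ∀ {m n} {k : Fin n} (v : Vec (Fin n) m) → (∀ i → toℕ k < toℕ (lookup v i)) → below k v ≡ true
below-intro []      h = ≡.refl
below-intro (l ∷ v) h = ∧-intro (<ᵇ-intro (h zero)) (below-intro v (h ∘ suc))

ascending-elim : ∀ {m n} (v : Vec (Fin n) m) → ascending v ≡ true → Ascending (lookup v)
ascending-elim (k ∷ v) h zero    (suc j) _           = below-elim v (proj₁ (∧-true h)) j
ascending-elim (k ∷ v) h (suc i) (suc j) (ℕ.s≤s i<j) = ascending-elim v (proj₂ (∧-true {a = below k v} h)) i j i<j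

ascending-intro : ∀ {m n} (v : Vec (Fin n) m) → Ascending (lookup v) → ascending v ≡ true
ascending-intro []      h = ≡.refl
ascending-intro (k ∷ v) h = ∧-intro (below-intro v λ i → h zero (suc i) (ℕ.s≤s ℕ.z≤n))
  (ascending-intro v λ i j i<j → h (suc i) (suc j) (ℕ.s≤s i<j))

-- No index lies strictly below `zero`. Hence the tail of an ascending vector avoids `zero` whatever
-- its head is, and can be relabelled through `suc`.
below⇒fresh-zero : ∀ {m n} {k : Fin (suc n)} (v : Vec (Fin (suc n)) m) → below k v ≡ true → fresh zero v ≡ true
below⇒fresh-zero v h = fresh-intro v λ i e → ℕₚ.n≮0 (≡.subst (λ l → _ < toℕ l) (≡.sym e) (below-elim v h i))

below-suc : ∀ {m n} (k : Fin n) (v : Vec (Fin n) m) → below (suc k) (Vec.map suc v) ≡ below k v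
below-suc k []      = ≡.refl
below-suc k (l ∷ v) = ≡.cong ((toℕ k <ᵇ toℕ l) ∧_) (below-suc k v)

below-zero : ∀ {m n} (v : Vec (Fin n) m) → below zero (Vec.map suc v) ≡ true
below-zero []      = ≡.refl
below-zero (l ∷ v) = below-zero v

ascending-suc : ∀ {m n} (v : Vec (Fin n) m) → ascending (Vec.map suc v) ≡ ascending v
ascending-suc []      = ≡.refl
ascending-suc (k ∷ v) = ≡.cong₂ _∧_ (below-suc k v) (ascending-suc v)

-- For each row i: leave it unmatched, or match it to the label τ i, or to the label σ i.
data Choice : Set where
  none viaτ viaσ : Choice

τ-rows σ-rows : ∀ {m} → Vec Choice m → Vec Bool m
τ-rows []         = []
τ-rows (none ∷ f) = false ∷ τ-rows f
τ-rows (viaτ ∷ f) = true  ∷ τ-rows f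
τ-rows (viaσ ∷ f) = false ∷ τ-rows f
σ-rows []         = []
σ-rows (none ∷ f) = false ∷ σ-rows f
σ-rows (viaτ ∷ f) = false ∷ σ-rows f
σ-rows (viaσ ∷ f) = true  ∷ σ-rows f

#true #false : ∀ {m} → Vec Bool m → ℕ
#true []          = 0
#true (true  ∷ p) = suc (#true p)
#true (false ∷ p) = #true p
#false []          = 0
#false (true  ∷ p) = #false p
#false (false ∷ p) = suc (#false p)

#true+#false : ∀ {m} (p : Vec Bool m) → #true p ℕ.+ #false p ≡ m
#true+#false []          = ≡.refl
#true+#false (true  ∷ p) = ≡.cong suc (#true+#false p)
#true+#false (false ∷ p) = ≡.trans (ℕₚ.+-suc _ _) (≡.cong suc (#true+#false p))

nCk*k!*[n∸k]! : ∀ {n k} → k ≤ n → (n C k) ℕ.* (k ! ℕ.* (n ∸ k) !) ≡ n !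
nCk*k!*[n∸k]! {n} {k} k≤n = ≡.trans (≡.cong (ℕ._* (k ! ℕ.* (n ∸ k) !)) (nCk≡n!/k![n-k]! k≤n))
  (m/n*n≡m {{k !* (n ∸ k) !≢0}} (k![n∸k]!∣n! k≤n))

-- A ring solver with integer coefficients

module IntegerSolver {c ℓ} (R : CommutativeRing c ℓ) where
  open CommutativeRing R
  open import Algebra.Properties.Ring ring
  open import Algebra.Properties.AbelianGroup +-abelianGroup using (⁻¹-∙-comm)
  open import Algebra.Properties.CommutativeSemigroup +-commutativeSemigroup using (interchange)
  open import Algebra.Properties.Semiring.Mult semiring using (×-homo-+; ×1-homo-*) renaming (_×_ to _×ᴿ_)
  open import Relation.Binary.Reasoning.Setoid setoid

  -- Integer coefficients, represented as formal differences of naturals.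
  differences : RawRing _ _
  differences = record
    { Carrier = ℕ × ℕ
    ; _≈_     = _≡_
    ; _+_     = λ { (m , n) (p , q) → m ℕ.+ p , n ℕ.+ q }
    ; _*_     = λ { (m , n) (p , q) → m ℕ.* p ℕ.+ n ℕ.* q , m ℕ.* q ℕ.+ n ℕ.* p }
    ; -_      = λ { (m , n) → n , m }
    ; 0#      = 0 , 0
    ; 1#      = 1 , 0
    }

  open RawRing differences using () renaming (_+_ to _+ᵈ_; _*_ to _*ᵈ_)

  ⟦_⟧ᵈ : ℕ × ℕ → Carrier
  ⟦ m , n ⟧ᵈ = m ×ᴿ 1# - n ×ᴿ 1#

  sub-+-interchange : ∀ a b c d → (a + b) - (c + d) ≈ (a - c) + (b - d)
  sub-+-interchange a b c d = trans (+-congˡ (sym (⁻¹-∙-comm c d))) (interchange a b (- c) (- d))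

  sub-*-sub : ∀ a b c d → (a - b) * (c - d) ≈ (a * c + b * d) - (a * d + b * c)
  sub-*-sub a b c d = begin
    (a - b) * (c - d)                              ≈⟨ distribʳ _ _ _ ⟩
    a * (c - d) + - b * (c - d)                    ≈⟨ +-cong (distribˡ _ _ _) (distribˡ _ _ _) ⟩
    (a * c + a * - d) + (- b * c + - b * - d)      ≈⟨ +-cong (+-congˡ (sym (-‿distribʳ-* a d)))
                                                        (trans (+-comm _ _) (+-cong
                                                          (trans (sym (-‿distribˡ-* b (- d))) (trans (-‿cong (sym (-‿distribʳ-* b d))) (-‿involutive _)))
                                                          (sym (-‿distribˡ-* b c)))) ⟩
    (a * c - a * d) + (b * d - b * c)              ≈⟨ sym (sub-+-interchange _ _ _ _) ⟩
    (a * c + b * d) - (a * d + b * c)              ∎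

  -- Agrees with ⟦_⟧ᵈ, but sends the two constants to 0# and 1# on the nose.
  ⟦_⟧ᶜ : ℕ × ℕ → Carrier
  ⟦ 0 , 0 ⟧ᶜ = 0#
  ⟦ 1 , 0 ⟧ᶜ = 1#
  ⟦ m , n ⟧ᶜ = ⟦ m , n ⟧ᵈ

  ⟦⟧ᶜ≈⟦⟧ᵈ : ∀ u → ⟦ u ⟧ᶜ ≈ ⟦ u ⟧ᵈ
  ⟦⟧ᶜ≈⟦⟧ᵈ (0 , 0)                = sym (-‿inverseʳ 0#)
  ⟦⟧ᶜ≈⟦⟧ᵈ (1 , 0)                = sym (trans (+-cong (+-identityʳ 1#) -0#≈0#) (+-identityʳ 1#))
  ⟦⟧ᶜ≈⟦⟧ᵈ (0 , suc n)            = refl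
  ⟦⟧ᶜ≈⟦⟧ᵈ (1 , suc n)            = refl
  ⟦⟧ᶜ≈⟦⟧ᵈ (suc (suc m) , 0)      = refl
  ⟦⟧ᶜ≈⟦⟧ᵈ (suc (suc m) , suc n)  = refl

  homomorphism : differences -Raw-AlmostCommutative⟶ fromCommutativeRing R
  homomorphism = record
    { ⟦_⟧    = ⟦_⟧ᶜ
    ; +-homo = λ { u@(m , n) v@(p , q) → trans (⟦⟧ᶜ≈⟦⟧ᵈ (u +ᵈ v)) (trans
        (+-cong (×-homo-+ 1# m p) (-‿cong (×-homo-+ 1# n q)))
        (trans (sub-+-interchange _ _ _ _) (sym (+-cong (⟦⟧ᶜ≈⟦⟧ᵈ u) (⟦⟧ᶜ≈⟦⟧ᵈ v))))) }
    ; *-homo = λ { u@(m , n) v@(p , q) → trans (⟦⟧ᶜ≈⟦⟧ᵈ (u *ᵈ v)) (trans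
        (+-cong (trans (×-homo-+ 1# (m ℕ.* p) (n ℕ.* q)) (+-cong (×1-homo-* m p) (×1-homo-* n q)))
          (-‿cong (trans (×-homo-+ 1# (m ℕ.* q) (n ℕ.* p)) (+-cong (×1-homo-* m q) (×1-homo-* n p)))))
        (trans (sym (sub-*-sub _ _ _ _)) (sym (*-cong (⟦⟧ᶜ≈⟦⟧ᵈ u) (⟦⟧ᶜ≈⟦⟧ᵈ v))))) }
    ; -‿homo = λ { u@(m , n) → trans (⟦⟧ᶜ≈⟦⟧ᵈ (n , m)) (trans
        (trans (trans (+-comm _ _) (+-congˡ (sym (-‿involutive _)))) (⁻¹-∙-comm _ _))
        (-‿cong (sym (⟦⟧ᶜ≈⟦⟧ᵈ u)))) }
    ; 0-homo = refl
    ; 1-homo = refl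
    }

  sub-eq : ∀ {a b c d} → a + d ≈ c + b → a - b ≈ c - d
  sub-eq {a} {b} {c} {d} h = begin
    a - b                ≈⟨ sym (trans (+-assoc _ _ _) (trans (+-congˡ (-‿inverseʳ d)) (+-identityʳ _))) ⟩
    ((a - b) + d) - d    ≈⟨ +-congʳ (trans (+-assoc _ _ _) (trans (+-congˡ (+-comm _ _)) (sym (+-assoc _ _ _)))) ⟩
    ((a + d) - b) - d    ≈⟨ +-congʳ (+-congʳ h) ⟩
    ((c + b) - b) - d    ≈⟨ +-congʳ (trans (+-assoc _ _ _) (trans (+-congˡ (-‿inverseʳ b)) (+-identityʳ _))) ⟩
    c - d                ∎

  -- Formal differences are not normalised, so equal integers may be different pairs and are
  -- compared by cross addition. A negative answer proves nothing, as different integers can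
  -- coincide in the ring.
  decide : ∀ x y → Maybe (⟦ x ⟧ᶜ ≈ ⟦ y ⟧ᶜ)
  decide u@(m , n) v@(p , q) with m ℕ.+ q ℕ.≟ p ℕ.+ n
  ... | no _   = nothing
  ... | yes eq = just (trans (⟦⟧ᶜ≈⟦⟧ᵈ u) (trans
    (sub-eq (trans (sym (×-homo-+ 1# m q)) (trans (reflexive (≡.cong (_×ᴿ 1#) eq)) (×-homo-+ 1# p n))))
    (sym (⟦⟧ᶜ≈⟦⟧ᵈ v))))

  open RingSolver differences (fromCommutativeRing R) homomorphism decide public
    using (solve; _:=_; _:+_; _:*_; :-_; _:-_; con; Polynomial)

  :1 :0 : ∀ {n} → Polynomial n
  :1 = con (1 , 0)
  :0 = con (0 , 0)

module Expansion {c ℓ} (Q : QAlgebra c ℓ) where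
  open QAlgebra Q hiding (zero)
  open IntegerSolver commRing using (solve; _:=_; _:+_; _:*_; :-_; _:-_; :1; :0)
  open import Algebra.Properties.Group +-group using () renaming (∙-cancelʳ to +-cancelʳ)
  open import Algebra.Properties.Ring ring using (-‿distribˡ-*)
  open import Algebra.Properties.Semiring.Sum semiring
  open import Relation.Binary.Reasoning.Setoid setoid

  -- Sums over Fin

  opaque
    ∑ : ∀ {n} → (Fin n → Carrier) → Carrier
    ∑ = sum

    ∑-empty : (f : Fin 0 → Carrier) → ∑ f ≈ 0#
    ∑-empty f = refl

    ∑-suc : ∀ {n} (f : Fin (suc n) → Carrier) → ∑ f ≈ f zero + ∑ (f ∘ suc)
    ∑-suc f = refl

    Σᶠ≡∑ : ∀ {n} (f : Fin n → Carrier) → Σᶠ Q f ≡ ∑ f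
    Σᶠ≡∑ {n} f = ≡.trans (≡.cong (sumL Q) (Listₚ.map-tabulate id f)) (sumL-tabulate f)
      where
      sumL-tabulate : ∀ {n} (f : Fin n → Carrier) → sumL Q (List.tabulate f) ≡ sum f
      sumL-tabulate {zero}  f = ≡.refl
      sumL-tabulate {suc n} f = ≡.cong (f zero +_) (sumL-tabulate (f ∘ suc))

    ∑-cong : ∀ {n} {f g : Fin n → Carrier} → (∀ i → f i ≈ g i) → ∑ f ≈ ∑ g
    ∑-cong = sum-cong-≋

    ∑-+ : ∀ {n} (f g : Fin n → Carrier) → ∑ (λ i → f i + g i) ≈ ∑ f + ∑ g
    ∑-+ = ∑-distrib-+

    ∑-*ˡ : ∀ {n} x (f : Fin n → Carrier) → ∑ (λ i → x * f i) ≈ x * ∑ f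
    ∑-*ˡ x f = sym (*-distribˡ-sum x f)

    ∑-removeAt : ∀ {n} (f : Fin (suc n) → Carrier) k → ∑ f ≈ f k + ∑ (f ∘ punchIn k)
    ∑-removeAt f k = sum-remove {i = k} f

    ∑-swap : ∀ {m n} (f : Fin m → Fin n → Carrier) → ∑ (λ i → ∑ (f i)) ≈ ∑ (λ j → ∑ (λ i → f i j))
    ∑-swap = ∑-comm

    ∑-0 : ∀ n → ∑ {n} (λ _ → 0#) ≈ 0#
    ∑-0 = sum-replicate-zero

  ∑-zero : ∀ {n} {f : Fin n → Carrier} → (∀ i → f i ≈ 0#) → ∑ f ≈ 0#
  ∑-zero {n} h = trans (∑-cong h) (∑-0 n)

  ∑-neg : ∀ {n} (f : Fin n → Carrier) → ∑ (λ i → - f i) ≈ - ∑ f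
  ∑-neg f = begin
    ∑ (λ i → - f i)       ≈⟨ ∑-cong (λ i → solve 1 (λ a → :- a := :- :1 :* a) refl (f i)) ⟩
    ∑ (λ i → - 1# * f i)  ≈⟨ ∑-*ˡ (- 1#) f ⟩
    - 1# * ∑ f            ≈⟨ solve 1 (λ a → :- :1 :* a := :- a) refl (∑ f) ⟩
    - ∑ f                 ∎

  ⟦_⟧ : Bool → Carrier
  ⟦ b ⟧ = if b then 1# else 0#

  δ : ∀ {n} → Fin n → Fin n → Carrier
  δ i j = ⟦ ⌊ i ≟ᶠ j ⌋ ⟧

  δ-suc : ∀ {n} (i j : Fin n) → δ (suc i) (suc j) ≡ δ i j
  δ-suc i j = ≡.cong ⟦_⟧ (≟-suc i j)

  ∑-δ : ∀ {n} (k : Fin n) (g : Fin n → Carrier) → ∑ (λ p → δ k p * g p) ≈ g k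
  ∑-δ zero    g = trans (∑-suc _) (trans (+-cong (*-identityˡ _) (∑-zero λ i → zeroˡ _)) (+-identityʳ _))
  ∑-δ (suc k) g = trans (∑-suc _) (trans (+-cong (zeroˡ _) (trans (∑-cong λ p → *-congʳ (reflexive (δ-suc k p))) (∑-δ k (g ∘ suc)))) (+-identityˡ _))

  -- The reindexing is a bijection. It sends (0, k) to (k+1, 0) and (j+1, 0) to (0, j), so these two
  -- families trade places; on pairs of successors it is the same map one size smaller.
  ∑-pairs-swap : ∀ {n} (G : Fin (suc n) → Fin n → Carrier) →
    ∑ (λ j → ∑ (λ k → G j k)) ≈ ∑ (λ j → ∑ (λ k → G (punchIn j k) (pinch k j)))
  ∑-pairs-swap {zero}  G = ∑-cong λ j → trans (∑-empty _) (sym (∑-empty _))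
  ∑-pairs-swap {suc n} G = begin
    ∑ (λ j → ∑ (λ k → G j k))
      ≈⟨ trans (∑-suc _) (+-congˡ (∑-cong λ j → ∑-suc (G (suc j)))) ⟩
    ∑ (G zero) + ∑ (λ j → G (suc j) zero + ∑ (λ k → G (suc j) (suc k)))
      ≈⟨ +-congˡ (∑-+ (λ j → G (suc j) zero) _) ⟩
    ∑ (G zero) + (∑ (λ j → G (suc j) zero) + ∑ (λ j → ∑ (λ k → G (suc j) (suc k))))
      ≈⟨ solve 3 (λ a b c → a :+ (b :+ c) := b :+ (a :+ c)) refl _ _ _ ⟩
    ∑ (λ j → G (suc j) zero) + (∑ (G zero) + ∑ (λ j → ∑ (λ k → G (suc j) (suc k))))
      ≈⟨ +-congˡ (+-congˡ (∑-pairs-swap (λ j k → G (suc j) (suc k)))) ⟩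
    ∑ (λ j → G (suc j) zero) + (∑ (G zero) + ∑ (λ j → ∑ (λ k → G (suc (punchIn j k)) (suc (pinch k j)))))
      ≈⟨ +-congˡ (sym (∑-+ (G zero) _)) ⟩
    ∑ (λ j → G (suc j) zero) + ∑ (λ j → G zero j + ∑ (λ k → G (suc (punchIn j k)) (suc (pinch k j))))
      ≈⟨ sym (trans (∑-suc _) (+-congˡ (∑-cong λ j → ∑-suc _))) ⟩
    ∑ (λ j → ∑ (λ k → G (punchIn j k) (pinch k j))) ∎

  -- Determinants

  pow : Carrier → ℕ → Carrier
  pow = _^_ Q

  alt : ∀ {n} → Fin n → Carrier
  alt j = pow (- 1#) (toℕ j)

  -- Listing the same two columns in the other order changes the sum of the two positions by exactly
  -- one.
  alt-pinch : ∀ {n} (j : Fin (suc n)) k → alt (punchIn j k) * alt (pinch k j) ≈ - (alt j * alt k)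
  alt-pinch zero    zero    = solve 0 ((:- :1 :* :1) :* :1 := :- (:1 :* :1)) refl
  alt-pinch zero    (suc k) = solve 1 (λ a → (:- :1 :* (:- :1 :* a)) :* :1 := :- (:1 :* (:- :1 :* a))) refl (alt k)
  alt-pinch (suc j) zero    = solve 1 (λ a → :1 :* a := :- ((:- :1 :* a) :* :1)) refl (alt j)
  alt-pinch (suc j) (suc k) = begin
    (- 1# * alt (punchIn j k)) * (- 1# * alt (pinch k j))
      ≈⟨ solve 2 (λ a b → (:- :1 :* a) :* (:- :1 :* b) := a :* b) refl _ _ ⟩
    alt (punchIn j k) * alt (pinch k j)
      ≈⟨ alt-pinch j k ⟩
    - (alt j * alt k)
      ≈⟨ solve 2 (λ a b → :- (a :* b) := :- ((:- :1 :* a) :* (:- :1 :* b))) refl _ _ ⟩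
    - ((- 1# * alt j) * (- 1# * alt k)) ∎

  Array : ℕ → ℕ → Set c
  Array m n = Fin m → Fin n → Carrier

  minor : ∀ {m n} → Array (suc m) (suc n) → Fin (suc n) → Array m n
  minor M j a b = M (suc a) (punchIn j b)

  opaque
    Det : ∀ {n} → Array n n → Carrier
    Det = det Q

    Det≡det : ∀ {n} (M : Array n n) → Det M ≡ det Q M
    Det≡det M = ≡.refl

    det-empty : (M : Array 0 0) → Det M ≈ 1#
    det-empty M = refl

    laplace : ∀ {n} (M : Array (suc n) (suc n)) → Det M ≈ ∑ (λ j → alt j * (M zero j * Det (minor M j)))
    laplace M = reflexive (Σᶠ≡∑ (λ j → alt j * (M zero j * det Q (minor M j))))

  laplace′ : ∀ {n} (M : Array (suc n) (suc n)) →
    Det M ≈ M zero zero * Det (minor M zero) + ∑ (λ j → - alt j * (M zero (suc j) * Det (minor M (suc j))))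
  laplace′ M = trans (laplace M) (trans (∑-suc _)
    (+-cong (*-identityˡ _) (∑-cong λ j → *-congʳ (solve 1 (λ a → :- :1 :* a := :- a) refl (alt j)))))

  det-cong : ∀ {n} {M N : Array n n} → (∀ i j → M i j ≈ N i j) → Det M ≈ Det N
  det-cong {zero}  {M} {N} h = trans (det-empty M) (sym (det-empty N))
  det-cong {suc n} {M} {N} h = begin
    Det M                                          ≈⟨ laplace M ⟩
    ∑ (λ j → alt j * (M zero j * Det (minor M j))) ≈⟨ ∑-cong (λ j → *-congˡ (*-cong (h zero j) (det-cong λ a b → h (suc a) (punchIn j b)))) ⟩
    ∑ (λ j → alt j * (N zero j * Det (minor N j))) ≈⟨ sym (laplace N) ⟩
    Det N                                          ∎

  det-diagonal : ∀ {n} (M : Array n n) (g : Fin n → Carrier) → (∀ i j → M i j ≈ δ i j * g i) →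
                 Det M ≈ V.foldr _*_ 1# g
  det-diagonal {zero}  M g h = det-empty M
  det-diagonal {suc n} M g h = begin
    Det M
      ≈⟨ laplace′ M ⟩
    M zero zero * Det (minor M zero) + ∑ (λ j → - alt j * (M zero (suc j) * Det (minor M (suc j))))
      ≈⟨ +-cong (*-cong (trans (h zero zero) (*-identityˡ _)) (det-diagonal (minor M zero) (g ∘ suc) λ i j → trans (h (suc i) (suc j)) (*-congʳ (reflexive (δ-suc i j)))))
           (∑-zero λ j → trans (*-congˡ (*-congʳ (trans (h zero (suc j)) (zeroˡ _))))
              (solve 2 (λ a d → :- a :* (:0 :* d) := :0) refl (alt j) _)) ⟩
    g zero * V.foldr _*_ 1# (g ∘ suc) + 0#
      ≈⟨ +-identityʳ _ ⟩
    g zero * V.foldr _*_ 1# (g ∘ suc) ∎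

  swapRows : ∀ {m n} → Array (suc (suc m)) n → Array (suc (suc m)) n
  swapRows M zero          = M (suc zero)
  swapRows M (suc zero)    = M zero
  swapRows M (suc (suc i)) = M (suc (suc i))

  laplace₂ : ∀ {n} (M : Array (suc (suc n)) (suc (suc n))) →
    Det M ≈ ∑ (λ j → ∑ (λ k → (alt j * alt k) * ((M zero j * M (suc zero) (punchIn j k)) * Det (minor (minor M j) k))))
  laplace₂ M = trans (laplace M) (∑-cong λ j → begin
    alt j * (M zero j * Det (minor M j))
      ≈⟨ *-congˡ (*-congˡ (laplace (minor M j))) ⟩
    alt j * (M zero j * ∑ _)
      ≈⟨ sym (*-assoc _ _ _) ⟩
    (alt j * M zero j) * ∑ _
      ≈⟨ sym (∑-*ˡ _ _) ⟩
    ∑ _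
      ≈⟨ ∑-cong (λ k → solve 5 (λ a m b p d → (a :* m) :* (b :* (p :* d)) := (a :* b) :* ((m :* p) :* d)) refl _ _ _ _ _) ⟩
    ∑ (λ k → (alt j * alt k) * ((M zero j * M (suc zero) (punchIn j k)) * Det (minor (minor M j) k))) ∎)

  -- Reindexing the double Laplace expansion by (j , k) ↦ (punchIn j k , pinch k j)
  -- exchanges the columns chosen in the first two rows and flips the sign.
  det-swapRows : ∀ {n} (M : Array (suc (suc n)) (suc (suc n))) → Det M ≈ - Det (swapRows M)
  det-swapRows M = begin
    Det M
      ≈⟨ laplace₂ M ⟩
    ∑ (λ j → ∑ (λ k → G j k))
      ≈⟨ ∑-pairs-swap G ⟩
    ∑ (λ j → ∑ (λ k → G (punchIn j k) (pinch k j)))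
      ≈⟨ ∑-cong (λ j → ∑-cong (λ k → flip j k)) ⟩
    ∑ (λ j → ∑ (λ k → - G′ j k))
      ≈⟨ trans (∑-cong (λ j → ∑-neg (G′ j))) (∑-neg _) ⟩
    - ∑ (λ j → ∑ (λ k → G′ j k))
      ≈⟨ -‿cong (sym (laplace₂ (swapRows M))) ⟩
    - Det (swapRows M) ∎
    where
    G G′ : ∀ j k → Carrier
    G  j k = (alt j * alt k) * ((M zero j * M (suc zero) (punchIn j k)) * Det (minor (minor M j) k))
    G′ j k = (alt j * alt k) * ((M (suc zero) j * M zero (punchIn j k)) * Det (minor (minor (swapRows M) j) k))
    flip : ∀ j k → G (punchIn j k) (pinch k j) ≈ - G′ j k
    flip j k = trans (*-cong (alt-pinch j k) (*-cong (trans
        (*-congˡ (reflexive (≡.cong (M (suc zero)) (punchIn-pinch j k)))) (*-comm _ _))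
        (det-cong λ a b → reflexive (≡.cong (M (suc (suc a))) (punchIn-punchIn-pinch j k b)))))
      (sym (-‿distribˡ-* _ _))

  -- Exchanging the equal rows gives D = -D, hence 2D = 0, and 2 is invertible in a ℚ-algebra.
  det-equalRows : ∀ {n} (M : Array (suc (suc n)) (suc (suc n))) → (∀ j → M zero j ≈ M (suc zero) j) → Det M ≈ 0#
  det-equalRows M h = begin
    -- The identity holds for every value of r. At r = 1/2 the first summand vanishes because 2r =
    -- 1, the second because D = -D.
    D                        ≈⟨ solve 2 (λ d r → d := (:1 :- (:1 :+ (:1 :+ :0)) :* r) :* d :+ r :* (d :+ d)) refl D (recip 2) ⟩
    (1# - ι 2 * recip 2) * D + recip 2 * (D + D)
      ≈⟨ +-cong (*-congʳ (+-congˡ (-‿cong (recip-inverse 2 λ ())))) (*-congˡ (+-congʳ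
           (trans (det-swapRows M) (-‿cong (det-cong {M = swapRows M} {N = M} same))))) ⟩
    (1# - 1#) * D + recip 2 * (- D + D)
      ≈⟨ solve 2 (λ d r → (:1 :- :1) :* d :+ r :* (:- d :+ d) := :0) refl D (recip 2) ⟩
    0#                       ∎
    where
    D = Det M
    same : ∀ i j → swapRows M i j ≈ M i j
    same zero          j = sym (h j)
    same (suc zero)    j = h j
    same (suc (suc i)) j = refl

  -- Bordered determinants and rank-one updates

  border : ∀ {m n} → Carrier → (Fin n → Carrier) → (Fin m → Carrier) → Array m n → Array (suc m) (suc n)
  border p q r K zero    zero    = p
  border p q r K zero    (suc j) = q j
  border p q r K (suc i) zero    = r i
  border p q r K (suc i) (suc j) = K i j

  border-cong : ∀ {m n} {p p′} {q q′ : Fin n → Carrier} {r r′ : Fin m → Carrier} {K K′ : Array m n} →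
    p ≈ p′ → (∀ j → q j ≈ q′ j) → (∀ i → r i ≈ r′ i) → (∀ i j → K i j ≈ K′ i j) →
    ∀ i j → border p q r K i j ≈ border p′ q′ r′ K′ i j
  border-cong hp hq hr hK zero    zero    = hp
  border-cong hp hq hr hK zero    (suc j) = hq j
  border-cong hp hq hr hK (suc i) zero    = hr i
  border-cong hp hq hr hK (suc i) (suc j) = hK i j

  -- Equal to - qᵀ adj(K) r.
  bordered : ∀ {n} → Array n n → (Fin n → Carrier) → (Fin n → Carrier) → Carrier
  bordered K q r = Det (border 0# q r K)

  bordered-cong : ∀ {n} {K : Array n n} {q q′ r r′ : Fin n → Carrier} → (∀ j → q j ≈ q′ j) → (∀ j → r j ≈ r′ j) → bordered K q r ≈ bordered K q′ r′
  bordered-cong hq hr = det-cong (border-cong refl hq hr λ _ _ → refl)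

  border-suc : ∀ {m n} {p p′ q q′} {r : Fin m → Carrier} {K : Array m n} i j →
    border p q r K (suc i) j ≡ border p′ q′ r K (suc i) j
  border-suc i zero    = ≡.refl
  border-suc i (suc j) = ≡.refl

  det-border : ∀ {n} p q r (K : Array n n) → Det (border p q r K) ≈ p * Det K + bordered K q r
  det-border {n} p q r K = begin
    Det (border p q r K)
      ≈⟨ laplace′ (border p q r K) ⟩
    p * Det K + ∑ (λ j → - alt j * (q j * Det (minor (border p q r K) (suc j))))
      ≈⟨ +-congˡ (∑-cong λ j → *-congˡ (*-congˡ (det-cong λ a b → reflexive (same p 0# j a b)))) ⟩
    p * Det K + ∑ (λ j → - alt j * (q j * Det (minor (border 0# q r K) (suc j))))
      ≈⟨ solve 3 (λ p d s → p :* d :+ s := p :* d :+ (:0 :* d :+ s)) refl _ _ _ ⟩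
    p * Det K + (0# * Det K + ∑ (λ j → - alt j * (q j * Det (minor (border 0# q r K) (suc j)))))
      ≈⟨ +-congˡ (sym (laplace′ (border 0# q r K))) ⟩
    p * Det K + bordered K q r ∎
    where
    same : ∀ p p′ j a b → minor (border p q r K) (suc j) a b ≡ minor (border p′ q r K) (suc j) a b
    same p p′ j a b = border-suc a (punchIn (suc j) b)

  -- Expanding along the border row would destroy the border. With the first row of `K` moved to the
  -- top, the minors at the columns of `K` are again bordered matrices, now around `minor K j`; the
  -- minor at the border column is `K` with its first row replaced by `q`.
  bordered-expand : ∀ {n} q r (K : Array (suc n) (suc n)) →
    bordered K q r ≈ - (r zero * Det (q V.∷ (K ∘ suc))) + ∑ (λ j → alt j * (K zero j * bordered (minor K j) (q ∘ punchIn j) (r ∘ suc)))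
  bordered-expand q r K = begin
    bordered K q r
      ≈⟨ det-swapRows (border 0# q r K) ⟩
    - Det B
      ≈⟨ -‿cong (laplace′ B) ⟩
    - (r zero * Det (minor B zero) + ∑ (λ j → - alt j * (K zero j * Det (minor B (suc j)))))
      ≈⟨ -‿cong (+-cong (*-congˡ (det-cong first))
           (trans (∑-cong λ j → trans (*-congˡ (*-congˡ (det-cong (rest j)))) (sym (-‿distribˡ-* _ _)))
                  (∑-neg (λ j → alt j * (K zero j * bordered (minor K j) (q ∘ punchIn j) (r ∘ suc)))))) ⟩
    - (r zero * Det (q V.∷ (K ∘ suc)) + - ∑ (λ j → alt j * (K zero j * bordered (minor K j) (q ∘ punchIn j) (r ∘ suc))))
      ≈⟨ solve 2 (λ a b → :- (a :+ :- b) := (:- a) :+ b) refl _ _ ⟩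
    - (r zero * Det (q V.∷ (K ∘ suc))) + ∑ (λ j → alt j * (K zero j * bordered (minor K j) (q ∘ punchIn j) (r ∘ suc))) ∎
    where
    B = swapRows (border 0# q r K)
    first : ∀ i j → minor B zero i j ≈ (q V.∷ (K ∘ suc)) i j
    first zero    j = refl
    first (suc i) j = refl
    rest : ∀ j a b → minor B (suc j) a b ≈ border 0# (q ∘ punchIn j) (r ∘ suc) (minor K j) a b
    rest j zero    zero    = refl
    rest j zero    (suc b) = refl
    rest j (suc a) zero    = refl
    rest j (suc a) (suc b) = refl

  -- The matrix determinant lemma, since the bordered determinant is minus the adjugate form.
  -- Induction along the first row produces the expansions of `Det K` and of `bordered K q r`, and
  -- one further sum in which `q` occurs twice.
  det-rankOne : ∀ {n} (K : Array n n) q r → Det (λ i j → K i j + r i * q j) ≈ Det K - bordered K q r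
  det-rankOne {zero}  K q r = begin
    Det (λ i j → K i j + r i * q j)  ≈⟨ det-cong (λ ()) ⟩
    Det K                            ≈⟨ solve 1 (λ d → d := d :- (:0 :* d :+ :0)) refl (Det K) ⟩
    Det K - (0# * Det K + 0#)        ≈⟨ +-congˡ (-‿cong (+-congˡ (sym (∑-empty _)))) ⟩
    Det K - (0# * Det K + ∑ _)       ≈⟨ +-congˡ (-‿cong (sym (laplace′ (border 0# q r K)))) ⟩
    Det K - bordered K q r                  ∎
  det-rankOne {suc n} K q r = begin
    Det (λ i j → K i j + r i * q j)
      ≈⟨ laplace _ ⟩
    ∑ (λ j → alt j * ((K zero j + r zero * q j) * Det (λ a b → minor K j a b + r (suc a) * q (punchIn j b))))
      ≈⟨ ∑-cong (λ j → trans (*-congˡ (*-congˡ (det-rankOne (minor K j) (q ∘ punchIn j) (r ∘ suc))))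
           (solve 6 (λ s k r₀ q d t → s :* ((k :+ r₀ :* q) :* (d :- t))
              := (s :* (k :* d) :+ r₀ :* (s :* (q :* d))) :+ :- (s :* (k :* t) :+ r₀ :* (s :* (q :* t)))) refl _ _ _ _ _ _)) ⟩
    ∑ (λ j → (Kd j + r zero * qd j) + - (Kc j + r zero * qc j))
      ≈⟨ trans (∑-+ (λ j → Kd j + r zero * qd j) _) (+-cong (split Kd qd) (trans (∑-neg _) (-‿cong (split Kc qc)))) ⟩
    (∑ Kd + r zero * ∑ qd) + - (∑ Kc + r zero * ∑ qc)
      ≈⟨ +-cong (+-cong (sym (laplace K)) (*-congˡ (sym (laplace (q V.∷ (K ∘ suc))))))
           (-‿cong (+-congˡ (*-congˡ vanish))) ⟩
    (Det K + r zero * Det (q V.∷ (K ∘ suc))) + - (∑ Kc + r zero * 0#)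
      ≈⟨ solve 4 (λ d r t s → (d :+ r :* t) :+ :- (s :+ r :* :0) := d :- (:- (r :* t) :+ s)) refl _ _ _ _ ⟩
    Det K - (- (r zero * Det (q V.∷ (K ∘ suc))) + ∑ Kc)
      ≈⟨ +-congˡ (-‿cong (sym (bordered-expand q r K))) ⟩
    Det K - bordered K q r ∎
    where
    Kd qd Kc qc : Fin (suc n) → Carrier
    Kd j = alt j * (K zero j * Det (minor K j))
    qd j = alt j * (q j * Det (minor K j))
    Kc j = alt j * (K zero j * bordered (minor K j) (q ∘ punchIn j) (r ∘ suc))
    qc j = alt j * (q j * bordered (minor K j) (q ∘ punchIn j) (r ∘ suc))
    split : ∀ f g → ∑ (λ j → f j + r zero * g j) ≈ ∑ f + r zero * ∑ g
    split f g = trans (∑-+ f _) (+-congˡ (∑-*ˡ (r zero) g))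
    -- Read backwards, `bordered-expand` identifies this sum with the bordered determinant in which
    -- the first row of `K` is `q` and the first entry of `r` is 0; its top two rows coincide.
    vanish : ∑ qc ≈ 0#
    vanish = begin
      ∑ qc                                        ≈⟨ solve 2 (λ s d → s := :- (:0 :* d) :+ s) refl (∑ qc) (Det (q V.∷ (K ∘ suc))) ⟩
      - (0# * Det (q V.∷ (K ∘ suc))) + ∑ qc     ≈⟨ sym (bordered-expand q (0# V.∷ (r ∘ suc)) (q V.∷ (K ∘ suc))) ⟩
      bordered (q V.∷ (K ∘ suc)) q (0# V.∷ (r ∘ suc))      ≈⟨ det-equalRows _ (λ { zero → refl ; (suc j) → refl }) ⟩
      0#                                            ∎

  ∑-linear : ∀ {n} s t (f g : Fin n → Carrier) → ∑ (λ j → s * f j + t * g j) ≈ s * ∑ f + t * ∑ g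
  ∑-linear s t f g = trans (∑-+ (λ j → s * f j) _) (+-cong (∑-*ˡ s f) (∑-*ˡ t g))

  -- The cofactors on the right do not involve `q`, which makes linearity in `q` visible.
  bordered-row : ∀ {n} (K : Array n n) q r →
    bordered K q r ≈ ∑ (λ j → q j * (- alt j * Det (minor (border 0# (λ _ → 0#) r K) (suc j))))
  bordered-row K q r = begin
    bordered K q r
      ≈⟨ laplace′ (border 0# q r K) ⟩
    0# * Det K + ∑ (λ j → - alt j * (q j * Det (minor (border 0# q r K) (suc j))))
      ≈⟨ trans (+-congʳ (zeroˡ _)) (+-identityˡ _) ⟩
    ∑ (λ j → - alt j * (q j * Det (minor (border 0# q r K) (suc j))))
      ≈⟨ ∑-cong (λ j → trans (*-congˡ (*-congˡ (det-cong λ a b → reflexive (border-suc a (punchIn (suc j) b)))))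
           (solve 3 (λ a q d → a :* (q :* d) := q :* (a :* d)) refl _ _ _)) ⟩
    ∑ (λ j → q j * (- alt j * Det (minor (border 0# (λ _ → 0#) r K) (suc j)))) ∎

  bordered-linearˡ : ∀ {n} (K : Array n n) s t u w r → bordered K (λ j → s * u j + t * w j) r ≈ s * bordered K u r + t * bordered K w r
  bordered-linearˡ K s t u w r = begin
    bordered K (λ j → s * u j + t * w j) r
      ≈⟨ bordered-row K _ r ⟩
    ∑ (λ j → (s * u j + t * w j) * κ j)
      ≈⟨ ∑-cong (λ j → solve 5 (λ s u t w k → (s :* u :+ t :* w) :* k := s :* (u :* k) :+ t :* (w :* k)) refl s (u j) t (w j) (κ j)) ⟩
    ∑ (λ j → s * (u j * κ j) + t * (w j * κ j))
      ≈⟨ ∑-linear s t _ _ ⟩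
    s * ∑ (λ j → u j * κ j) + t * ∑ (λ j → w j * κ j)
      ≈⟨ sym (+-cong (*-congˡ (bordered-row K u r)) (*-congˡ (bordered-row K w r))) ⟩
    s * bordered K u r + t * bordered K w r ∎
    where κ = λ j → - alt j * Det (minor (border 0# (λ _ → 0#) r K) (suc j))

  -- The determinant is defined by row expansion, so linearity in a column takes an induction of its
  -- own: column zero is gone from its own minor and is again the first column of every other minor.
  det-linear-column : ∀ {n} (L M N : Array (suc n) (suc n)) s t →
    (∀ a → N a zero ≈ s * L a zero + t * M a zero) →
    (∀ a b → L a (suc b) ≈ N a (suc b)) → (∀ a b → M a (suc b) ≈ N a (suc b)) →
    Det N ≈ s * Det L + t * Det M
  det-linear-column {n} L M N s t h hL hM = begin
    Det N
      ≈⟨ laplace′ N ⟩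
    N zero zero * Det (minor N zero) + ∑ (λ j → - alt j * (N zero (suc j) * Det (minor N (suc j))))
      ≈⟨ +-cong (*-congʳ (h zero)) (trans (∑-cong rest) (∑-linear s t _ _)) ⟩
    (s * L zero zero + t * M zero zero) * Det (minor N zero) + (s * ∑ fL + t * ∑ fM)
      ≈⟨ solve 7 (λ s l t m d p q → (s :* l :+ t :* m) :* d :+ (s :* p :+ t :* q)
           := s :* (l :* d :+ p) :+ t :* (m :* d :+ q)) refl _ _ _ _ _ _ _ ⟩
    s * (L zero zero * Det (minor N zero) + ∑ fL) + t * (M zero zero * Det (minor N zero) + ∑ fM)
      ≈⟨ +-cong (*-congˡ (+-congʳ (*-congˡ (det-cong λ a b → sym (hL (suc a) b)))))
                (*-congˡ (+-congʳ (*-congˡ (det-cong λ a b → sym (hM (suc a) b))))) ⟩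
    s * (L zero zero * Det (minor L zero) + ∑ fL) + t * (M zero zero * Det (minor M zero) + ∑ fM)
      ≈⟨ sym (+-cong (*-congˡ (laplace′ L)) (*-congˡ (laplace′ M))) ⟩
    s * Det L + t * Det M ∎
    where
    fL fM : Fin n → Carrier
    fL j = - alt j * (L zero (suc j) * Det (minor L (suc j)))
    fM j = - alt j * (M zero (suc j) * Det (minor M (suc j)))
    -- An index `j : Fin n` excludes n = 0, so the minor still has a column zero and the induction
    -- applies to it.
    minors : ∀ {n} (L M N : Array (suc n) (suc n)) →
      (∀ a → N a zero ≈ s * L a zero + t * M a zero) →
      (∀ a b → L a (suc b) ≈ N a (suc b)) → (∀ a b → M a (suc b) ≈ N a (suc b)) →
      ∀ j → Det (minor N (suc j)) ≈ s * Det (minor L (suc j)) + t * Det (minor M (suc j))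
    minors {suc n} L M N h hL hM j = det-linear-column (minor L (suc j)) (minor M (suc j)) (minor N (suc j)) s t
      (λ a → h (suc a)) (λ a b → hL (suc a) (punchIn j b)) (λ a b → hM (suc a) (punchIn j b))
    rest : ∀ j → - alt j * (N zero (suc j) * Det (minor N (suc j))) ≈ s * fL j + t * fM j
    rest j = begin
      - alt j * (N zero (suc j) * Det (minor N (suc j)))
        ≈⟨ *-congˡ (*-congˡ (minors L M N h hL hM j)) ⟩
      - alt j * (N zero (suc j) * (s * Det (minor L (suc j)) + t * Det (minor M (suc j))))
        ≈⟨ solve 6 (λ a n s d t e → a :* (n :* (s :* d :+ t :* e)) := s :* (a :* (n :* d)) :+ t :* (a :* (n :* e)))
             refl (- alt j) _ _ _ _ _ ⟩
      s * (- alt j * (N zero (suc j) * Det (minor L (suc j)))) + t * (- alt j * (N zero (suc j) * Det (minor M (suc j))))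
        ≈⟨ sym (+-cong (*-congˡ (*-congˡ (*-congʳ (hL zero j)))) (*-congˡ (*-congˡ (*-congʳ (hM zero j))))) ⟩
      s * fL j + t * fM j ∎

  bordered-linearʳ : ∀ {n} (K : Array n n) s t q u w → bordered K q (λ j → s * u j + t * w j) ≈ s * bordered K q u + t * bordered K q w
  bordered-linearʳ K s t q u w = det-linear-column (border 0# q u K) (border 0# q w K) _ s t
    (λ { zero → solve 2 (λ s t → :0 := s :* :0 :+ t :* :0) refl s t ; (suc a) → refl })
    (λ { zero b → refl ; (suc a) b → refl })
    (λ { zero b → refl ; (suc a) b → refl })

  bordered-quadratic : ∀ {n} (K : Array n n) s t u w → bordered K (λ j → s * u j + t * w j) (λ j → s * u j + t * w j) ≈
    (s * s) * bordered K u u + (s * t) * (bordered K u w + bordered K w u) + (t * t) * bordered K w w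
  bordered-quadratic K s t u w = begin
    bordered K (λ j → s * u j + t * w j) v
      ≈⟨ bordered-linearˡ K s t u w v ⟩
    s * bordered K u v + t * bordered K w v
      ≈⟨ +-cong (*-congˡ (bordered-linearʳ K s t u u w)) (*-congˡ (bordered-linearʳ K s t w u w)) ⟩
    s * (s * bordered K u u + t * bordered K u w) + t * (s * bordered K w u + t * bordered K w w)
      ≈⟨ solve 6 (λ s t a b d e → s :* (s :* a :+ t :* b) :+ t :* (s :* d :+ t :* e)
           := (s :* s) :* a :+ (s :* t) :* (b :+ d) :+ (t :* t) :* e) refl s t _ _ _ _ ⟩
    (s * s) * bordered K u u + (s * t) * (bordered K u w + bordered K w u) + (t * t) * bordered K w w ∎
    where v = λ j → s * u j + t * w j

  -- Weighted Gram matrices and the one-row recursion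

  ν : ∀ {n} → Fin n → Fin n → Carrier
  ν k l = 1# - δ k l

  infixl 7 _∖_
  _∖_ : ∀ {n} → (Fin n → Carrier) → Fin n → (Fin n → Carrier)
  (χ ∖ k) l = ν k l * χ l

  -- χ weights the columns of N, so that χ ∖ k deletes column k.
  gram : ∀ {m n} → Carrier → (Fin n → Carrier) → Array m n → Array m m
  gram x χ N i j = x * δ i j - ∑ (λ l → χ l * (N i l * N j l))

  gram-∖ : ∀ {m n} x χ (N : Array m n) k i j →
    gram x (χ ∖ k) N i j ≈ gram x χ N i j + (χ k * N i k) * N j k
  gram-∖ x χ N k i j = begin
    x * δ i j - ∑ (λ l → (χ ∖ k) l * (N i l * N j l))
      ≈⟨ +-congˡ (-‿cong (∑-cong λ l → solve 3 (λ d h g → (:1 :- d) :* h :* g := h :* g :+ :- (d :* (h :* g))) refl (δ k l) (χ l) (N i l * N j l))) ⟩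
    x * δ i j - ∑ (λ l → χ l * (N i l * N j l) + - (δ k l * (χ l * (N i l * N j l))))
      ≈⟨ +-congˡ (-‿cong (trans (∑-+ (λ l → χ l * (N i l * N j l)) _) (+-congˡ (trans (∑-neg _) (-‿cong (∑-δ k _)))))) ⟩
    x * δ i j - (∑ (λ l → χ l * (N i l * N j l)) + - (χ k * (N i k * N j k)))
      ≈⟨ solve 5 (λ a s h p q → a :- (s :+ :- (h :* (p :* q))) := (a :- s) :+ (h :* p) :* q) refl _ _ _ _ _ ⟩
    gram x χ N i j + (χ k * N i k) * N j k ∎

  -- Used from right to left: it trades a bordered term for a determinant with a deleted column, and
  -- so the recursion closes within the family `Det (gram x χ N)`.
  det-gram-∖ : ∀ {m n} x χ (N : Array m n) k →
    Det (gram x (χ ∖ k) N) ≈ Det (gram x χ N) - χ k * bordered (gram x χ N) (λ i → N i k) (λ i → N i k)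
  det-gram-∖ x χ N k = begin
    Det (gram x (χ ∖ k) N)
      ≈⟨ det-cong (gram-∖ x χ N k) ⟩
    Det (λ i j → gram x χ N i j + (χ k * N i k) * N j k)
      ≈⟨ det-rankOne (gram x χ N) _ _ ⟩
    Det (gram x χ N) - bordered (gram x χ N) u (λ i → χ k * u i)
      -- A scaling is a linear combination whose second coefficient is 0, the form that
      -- `bordered-linearʳ` expects.
      ≈⟨ +-congˡ (-‿cong (bordered-cong (λ _ → refl) λ i → solve 2 (λ h a → h :* a := h :* a :+ :0 :* a) refl (χ k) (u i))) ⟩
    Det (gram x χ N) - bordered (gram x χ N) u (λ i → χ k * u i + 0# * u i)
      ≈⟨ +-congˡ (-‿cong (trans (bordered-linearʳ (gram x χ N) (χ k) 0# u u u) (trans (+-congˡ (zeroˡ _)) (+-identityʳ _)))) ⟩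
    Det (gram x χ N) - χ k * bordered (gram x χ N) u u ∎
    where u = λ i → N i k

  -- The labels `k` and `l` may coincide, as happens where τ i = σ i; the two entries then add up.
  twoPoint : ∀ {n} → Carrier → Fin n → Carrier → Fin n → Fin n → Carrier
  twoPoint α k β l p = α * δ k p + β * δ l p

  ∑-twoPoint : ∀ {n} (χ : Fin n → Carrier) α (k : Fin n) β l (g : Fin n → Carrier) →
    ∑ (λ p → χ p * (twoPoint α k β l p * g p)) ≈ α * (χ k * g k) + β * (χ l * g l)
  ∑-twoPoint χ α k β l g = begin
    ∑ (λ p → χ p * (twoPoint α k β l p * g p))
      ≈⟨ ∑-cong (λ p → solve 6 (λ h a d b e g → h :* ((a :* d :+ b :* e) :* g) := a :* (d :* (h :* g)) :+ b :* (e :* (h :* g)))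
           refl (χ p) α (δ k p) β (δ l p) (g p)) ⟩
    ∑ (λ p → α * (δ k p * (χ p * g p)) + β * (δ l p * (χ p * g p)))
      ≈⟨ ∑-linear α β _ _ ⟩
    α * ∑ (λ p → δ k p * (χ p * g p)) + β * ∑ (λ p → δ l p * (χ p * g p))
      ≈⟨ +-cong (*-congˡ (∑-δ k _)) (*-congˡ (∑-δ l _)) ⟩
    α * (χ k * g k) + β * (χ l * g l) ∎

  δ-refl : ∀ {n} (k : Fin n) → δ k k ≡ 1#
  δ-refl k with k ≟ᶠ k
  ... | yes _ = ≡.refl
  ... | no ¬p with () ← ¬p ≡.refl

  -- The right side is sorted by powers of `β`. The part linear in `β` collects the mixed bordered
  -- terms and the `δ` terms for coinciding labels, so that reversing the sign of `β` removes both
  -- at once.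
  det-gram-∷ : ∀ {m n} x (χ : Fin n → Carrier) α k β l (N : Array m n) →
    let K = gram x χ N ; u = λ i → N i k ; w = λ i → N i l in
    Det (gram x χ (twoPoint α k β l V.∷ N)) ≈
      (x - (α * α * χ k + β * β * χ l + β * (α * (χ k * δ l k + χ l * δ k l)))) * Det K
      + (α * α * (χ k * (χ k * bordered K u u)) + β * (α * χ k * χ l * (bordered K u w + bordered K w u)) + β * β * (χ l * (χ l * bordered K w w)))
  det-gram-∷ {m} {n} x χ α k β l N = begin
    Det (gram x χ (v V.∷ N))
      ≈⟨ det-cong entry ⟩
    Det (border p q q K)
      ≈⟨ det-border p q q K ⟩
    p * Det K + bordered K q q
      ≈⟨ +-congˡ (bordered-quadratic K (- (α * χ k)) (- (β * χ l)) u w) ⟩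
    p * Det K + ((- (α * χ k) * - (α * χ k)) * bordered K u u + (- (α * χ k) * - (β * χ l)) * (bordered K u w + bordered K w u)
      + (- (β * χ l) * - (β * χ l)) * bordered K w w)
      ≈⟨ +-congˡ (solve 7 (λ a h b g p q r → ((:- (a :* h) :* (:- (a :* h))) :* p :+ (:- (a :* h) :* (:- (b :* g))) :* q :+ (:- (b :* g) :* (:- (b :* g))) :* r)
          := (a :* a :* (h :* (h :* p)) :+ b :* (a :* h :* g :* q) :+ b :* b :* (g :* (g :* r)))) refl α (χ k) β (χ l) _ _ _) ⟩
    p * Det K
      + (α * α * (χ k * (χ k * bordered K u u)) + β * (α * χ k * χ l * (bordered K u w + bordered K w u)) + β * β * (χ l * (χ l * bordered K w w))) ∎
    where
    v = twoPoint α k β l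
    K = gram x χ N
    u w : Fin m → Carrier
    u i = N i k
    w i = N i l
    p : Carrier
    p = x - (α * α * χ k + β * β * χ l + β * (α * (χ k * δ l k + χ l * δ k l)))
    q : Fin m → Carrier
    q i = - (α * χ k) * u i + - (β * χ l) * w i
    corner : gram x χ (v V.∷ N) zero zero ≈ p
    corner = begin
      x * 1# - ∑ (λ l → χ l * (v l * v l))
        ≈⟨ +-cong (*-identityʳ x) (-‿cong (∑-twoPoint χ α k β l v)) ⟩
      x - (α * (χ k * (α * δ k k + β * δ l k)) + β * (χ l * (α * δ k l + β * δ l l)))
        ≈⟨ +-congˡ (-‿cong (+-cong (*-congˡ (*-congˡ (+-congʳ (*-congˡ (reflexive (δ-refl k))))))
             (*-congˡ (*-congˡ (+-congˡ (*-congˡ (reflexive (δ-refl l)))))))) ⟩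
      x - (α * (χ k * (α * 1# + β * δ l k)) + β * (χ l * (α * δ k l + β * 1#)))
        ≈⟨ solve 7 (λ x a b h g d e → x :- (a :* (h :* (a :* :1 :+ b :* d)) :+ b :* (g :* (a :* e :+ b :* :1)))
             := x :- (a :* a :* h :+ b :* b :* g :+ b :* (a :* (h :* d :+ g :* e)))) refl x α β (χ k) (χ l) (δ l k) (δ k l) ⟩
      p ∎
    edge : ∀ j → x * 0# - ∑ (λ l → χ l * (v l * N j l)) ≈ q j
    edge j = begin
      x * 0# - ∑ (λ l → χ l * (v l * N j l))
        ≈⟨ +-congˡ (-‿cong (∑-twoPoint χ α k β l (N j))) ⟩
      x * 0# - (α * (χ k * u j) + β * (χ l * w j))
        ≈⟨ solve 7 (λ x a b h g u w → x :* :0 :- (a :* (h :* u) :+ b :* (g :* w)) := :- (a :* h) :* u :+ :- (b :* g) :* w) refl x α β (χ k) (χ l) _ _ ⟩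
      q j ∎
    entry : ∀ i j → gram x χ (v V.∷ N) i j ≈ border p q q K i j
    entry zero    zero    = corner
    entry zero    (suc j) = edge j
    entry (suc i) zero    = trans (+-congˡ (-‿cong (∑-cong λ l → *-congˡ (*-comm _ _)))) (edge i)
    entry (suc i) (suc j) = +-congʳ (*-congˡ (reflexive (δ-suc i j)))

  -- The two signs cancel everything that is odd in β; what is left is the
  -- matching recursion: row 0 is unmatched, or matched to column k, or to column l.
  det-gram-±∷ : ∀ {m n} x (χ : Fin n → Carrier) α k β l (N : Array m n) →
    Det (gram x χ (twoPoint α k β l V.∷ N)) + Det (gram x χ (twoPoint α k (- β) l V.∷ N)) ≈
    ι 2 * (x * Det (gram x χ N) - α * α * (χ k * Det (gram x (χ ∖ k) N)) - β * β * (χ l * Det (gram x (χ ∖ l) N)))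
  det-gram-±∷ x χ α k β l N = begin
    Det (gram x χ (twoPoint α k β l V.∷ N)) + Det (gram x χ (twoPoint α k (- β) l V.∷ N))
      ≈⟨ +-cong (det-gram-∷ x χ α k β l N) (det-gram-∷ x χ α k (- β) l N) ⟩
    _ ≈⟨ solve 10 (λ x a b h g s d p y r →
           ((x :- (a :* a :* h :+ b :* b :* g :+ b :* s)) :* d :+ (a :* a :* (h :* (h :* p)) :+ b :* y :+ b :* b :* (g :* (g :* r))))
           :+ ((x :- (a :* a :* h :+ (:- b) :* (:- b) :* g :+ (:- b) :* s)) :* d
               :+ (a :* a :* (h :* (h :* p)) :+ (:- b) :* y :+ (:- b) :* (:- b) :* (g :* (g :* r))))
           := (:1 :+ (:1 :+ :0)) :* (x :* d :- a :* a :* (h :* (d :- h :* p)) :- b :* b :* (g :* (d :- g :* r)))) refl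
           x α β (χ k) (χ l) _ (Det K) (bordered K u u) _ (bordered K w w) ⟩
    ι 2 * (x * Det K - α * α * (χ k * (Det K - χ k * bordered K u u)) - β * β * (χ l * (Det K - χ l * bordered K w w)))
      ≈⟨ sym (*-congˡ (+-cong (+-congˡ (-‿cong (*-congˡ (*-congˡ (det-gram-∖ x χ N k)))))
           (-‿cong (*-congˡ (*-congˡ (det-gram-∖ x χ N l)))))) ⟩
    _ ∎
    where
    K = gram x χ N
    u = λ i → N i k
    w = λ i → N i l

  ι-+ : ∀ m n → ι (m ℕ.+ n) ≈ ι m + ι n
  ι-+ zero    n = sym (+-identityˡ _)
  ι-+ (suc m) n = trans (+-congˡ (ι-+ m n)) (sym (+-assoc _ _ _))

  ι-* : ∀ m n → ι (m ℕ.* n) ≈ ι m * ι n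
  ι-* zero    n = sym (zeroˡ _)
  ι-* (suc m) n = trans (ι-+ n (m ℕ.* n)) (trans (+-congˡ (ι-* m n))
    (solve 2 (λ a b → b :+ a :* b := (:1 :+ a) :* b) refl (ι m) (ι n)))

  ι-1 : ι 1 ≈ 1#
  ι-1 = +-identityʳ 1#

  ∑-const : ∀ n x → ∑ {n} (λ _ → x) ≈ ι n * x
  ∑-const zero    x = trans (∑-empty _) (sym (zeroˡ x))
  ∑-const (suc n) x = trans (∑-suc _) (trans (+-congˡ (∑-const n x))
    (solve 2 (λ a x → x :+ a :* x := (:1 :+ a) :* x) refl (ι n) x))

  -- Sums over vectors of indices

  opaque
    ∑ⱽ : ∀ {m n} → (Vec (Fin n) m → Carrier) → Carrier
    ∑ⱽ {zero}  F = F []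
    ∑ⱽ {suc m} F = ∑ λ k → ∑ⱽ λ v → F (k ∷ v)

    ∑ⱽ-[] : ∀ {n} (F : Vec (Fin n) 0 → Carrier) → ∑ⱽ F ≈ F []
    ∑ⱽ-[] F = refl

    ∑ⱽ-∷ : ∀ {m n} (F : Vec (Fin n) (suc m) → Carrier) → ∑ⱽ F ≈ ∑ λ k → ∑ⱽ λ v → F (k ∷ v)
    ∑ⱽ-∷ F = refl

    ∑ⱽ-cong : ∀ {m n} {F G : Vec (Fin n) m → Carrier} → (∀ v → F v ≈ G v) → ∑ⱽ F ≈ ∑ⱽ G
    ∑ⱽ-cong {zero}  h = h []
    ∑ⱽ-cong {suc m} h = ∑-cong λ k → ∑ⱽ-cong λ v → h (k ∷ v)

    ∑ⱽ-+ : ∀ {m n} (F G : Vec (Fin n) m → Carrier) → ∑ⱽ (λ v → F v + G v) ≈ ∑ⱽ F + ∑ⱽ G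
    ∑ⱽ-+ {zero}  F G = refl
    ∑ⱽ-+ {suc m} F G = trans (∑-cong λ k → ∑ⱽ-+ (λ v → F (k ∷ v)) λ v → G (k ∷ v)) (∑-+ _ _)

    ∑ⱽ-*ˡ : ∀ {m n} x (F : Vec (Fin n) m → Carrier) → ∑ⱽ (λ v → x * F v) ≈ x * ∑ⱽ F
    ∑ⱽ-*ˡ {zero}  x F = refl
    ∑ⱽ-*ˡ {suc m} x F = trans (∑-cong λ k → ∑ⱽ-*ˡ x λ v → F (k ∷ v)) (∑-*ˡ x _)

    ∑ⱽ-∑ : ∀ {m n p} (G : Fin p → Vec (Fin n) m → Carrier) → ∑ⱽ (λ v → ∑ λ k → G k v) ≈ ∑ (λ k → ∑ⱽ (G k))
    ∑ⱽ-∑ {zero}  G = refl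
    ∑ⱽ-∑ {suc m} G = trans (∑-cong λ l → ∑ⱽ-∑ λ k v → G k (l ∷ v)) (∑-swap _)

    ∑ⱽ-swap : ∀ {m n p q} (G : Vec (Fin n) m → Vec (Fin q) p → Carrier) →
      ∑ⱽ (λ v → ∑ⱽ λ w → G v w) ≈ ∑ⱽ (λ w → ∑ⱽ λ v → G v w)
    ∑ⱽ-swap {zero}  G = refl
    ∑ⱽ-swap {suc m} G = trans (∑-cong λ k → ∑ⱽ-swap λ v → G (k ∷ v)) (sym (∑ⱽ-∑ λ k w → ∑ⱽ λ v → G (k ∷ v) w))

  ∑ⱽ-const : ∀ m {n} y → ∑ⱽ {m} {n} (λ _ → y) ≈ pow (ι n) m * y
  ∑ⱽ-const zero        y = trans (∑ⱽ-[] _) (sym (*-identityˡ y))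
  ∑ⱽ-const (suc m) {n} y = trans (∑ⱽ-∷ _) (trans (∑-cong λ _ → ∑ⱽ-const m y) (trans (∑-const n _) (sym (*-assoc _ _ _))))

  ⟦∧⟧ : ∀ a b → ⟦ a ∧ b ⟧ ≈ ⟦ a ⟧ * ⟦ b ⟧
  ⟦∧⟧ true  b = sym (*-identityˡ _)
  ⟦∧⟧ false b = sym (zeroˡ _)

  ∑-avoid : ∀ {n} k (g : Fin (suc n) → Carrier) → ∑ (λ l → ⟦ not ⌊ k ≟ᶠ l ⌋ ⟧ * g l) ≈ ∑ (λ l → g (punchIn k l))
  ∑-avoid k g = begin
    ∑ (λ l → ⟦ not ⌊ k ≟ᶠ l ⌋ ⟧ * g l)
      ≈⟨ ∑-removeAt _ k ⟩
    ⟦ not ⌊ k ≟ᶠ k ⌋ ⟧ * g k + ∑ (λ l → ⟦ not ⌊ k ≟ᶠ punchIn k l ⌋ ⟧ * g (punchIn k l))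
      ≈⟨ +-cong (trans (*-congʳ (reflexive (≡.cong (⟦_⟧ ∘ not) (≟-refl k)))) (zeroˡ _))
           (∑-cong λ l → trans (*-congʳ (reflexive (≡.cong (⟦_⟧ ∘ not) (≟-≢ (punchInᵢ≢i k l ∘ ≡.sym))))) (*-identityˡ _)) ⟩
    0# + ∑ (λ l → g (punchIn k l))
      ≈⟨ +-identityˡ _ ⟩
    ∑ (λ l → g (punchIn k l)) ∎

  -- Entry by entry, `punchIn k` lists the labels other than `k` once each.
  ∑ⱽ-fresh : ∀ {m n} k (G : Vec (Fin (suc n)) m → Carrier) →
    ∑ⱽ (λ v → ⟦ fresh k v ⟧ * G v) ≈ ∑ⱽ (λ v → G (Vec.map (punchIn k) v))
  ∑ⱽ-fresh {zero}  k G = trans (∑ⱽ-[] _) (trans (*-identityˡ _) (sym (∑ⱽ-[] _)))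
  ∑ⱽ-fresh {suc m} k G = begin
    ∑ⱽ (λ v → ⟦ fresh k v ⟧ * G v)
      ≈⟨ ∑ⱽ-∷ _ ⟩
    ∑ (λ l → ∑ⱽ λ v → ⟦ not ⌊ k ≟ᶠ l ⌋ ∧ fresh k v ⟧ * G (l ∷ v))
      ≈⟨ ∑-cong (λ l → trans (∑ⱽ-cong λ v → trans (*-congʳ (⟦∧⟧ (not ⌊ k ≟ᶠ l ⌋) (fresh k v))) (*-assoc _ _ _)) (∑ⱽ-*ˡ _ _)) ⟩
    ∑ (λ l → ⟦ not ⌊ k ≟ᶠ l ⌋ ⟧ * ∑ⱽ λ v → ⟦ fresh k v ⟧ * G (l ∷ v))
      ≈⟨ ∑-avoid k _ ⟩
    ∑ (λ l → ∑ⱽ λ v → ⟦ fresh k v ⟧ * G (punchIn k l ∷ v))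
      ≈⟨ ∑-cong (λ l → ∑ⱽ-fresh k λ v → G (punchIn k l ∷ v)) ⟩
    ∑ (λ l → ∑ⱽ λ v → G (punchIn k l ∷ Vec.map (punchIn k) v))
      ≈⟨ sym (∑ⱽ-∷ _) ⟩
    ∑ⱽ (λ v → G (Vec.map (punchIn k) v)) ∎

  -- For m = n a sum over permutations. Distinctness is a 0/1 factor and not a restriction of the
  -- range, so linearity and interchange are inherited from `∑ⱽ`.
  ∑ᴰ : ∀ {m n} → (Vec (Fin n) m → Carrier) → Carrier
  ∑ᴰ G = ∑ⱽ λ v → ⟦ distinct v ⟧ * G v

  ∑ᴰ-cong : ∀ {m n} {F G : Vec (Fin n) m → Carrier} → (∀ v → F v ≈ G v) → ∑ᴰ F ≈ ∑ᴰ G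
  ∑ᴰ-cong h = ∑ⱽ-cong λ v → *-congˡ (h v)

  ∑ᴰ-+ : ∀ {m n} (F G : Vec (Fin n) m → Carrier) → ∑ᴰ (λ v → F v + G v) ≈ ∑ᴰ F + ∑ᴰ G
  ∑ᴰ-+ F G = trans (∑ⱽ-cong λ v → distribˡ _ _ _) (∑ⱽ-+ _ _)

  ∑ᴰ-*ˡ : ∀ {m n} x (F : Vec (Fin n) m → Carrier) → ∑ᴰ (λ v → x * F v) ≈ x * ∑ᴰ F
  ∑ᴰ-*ˡ x F = trans (∑ⱽ-cong λ v → solve 3 (λ a b c → a :* (b :* c) := b :* (a :* c)) refl _ _ _) (∑ⱽ-*ˡ x _)

  ∑ⱽ-∑ᴰ : ∀ {m n p q} (G : Vec (Fin n) m → Vec (Fin q) p → Carrier) → ∑ⱽ (λ s → ∑ᴰ (G s)) ≈ ∑ᴰ (λ v → ∑ⱽ λ s → G s v)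
  ∑ⱽ-∑ᴰ G = trans (∑ⱽ-swap _) (∑ⱽ-cong λ v → ∑ⱽ-*ˡ _ _)

  ∑ᴰ-[] : ∀ {n} (G : Vec (Fin n) 0 → Carrier) → ∑ᴰ G ≈ G []
  ∑ᴰ-[] G = trans (∑ⱽ-[] _) (*-identityˡ _)

  -- Once the first value is `k`, the remaining values form a repetition-free vector in the other
  -- labels, which are renumbered. All inductions over permutations rest on this.
  ∑ᴰ-∷ : ∀ {m n} (G : Vec (Fin (suc n)) (suc m) → Carrier) → ∑ᴰ G ≈ ∑ (λ k → ∑ᴰ λ v → G (k ∷ Vec.map (punchIn k) v))
  ∑ᴰ-∷ G = begin
    ∑ᴰ G
      ≈⟨ ∑ⱽ-∷ _ ⟩
    ∑ (λ k → ∑ⱽ λ v → ⟦ fresh k v ∧ distinct v ⟧ * G (k ∷ v))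
      ≈⟨ ∑-cong (λ k → ∑ⱽ-cong λ v → trans (*-congʳ (⟦∧⟧ (fresh k v) (distinct v))) (*-assoc _ _ _)) ⟩
    ∑ (λ k → ∑ⱽ λ v → ⟦ fresh k v ⟧ * (⟦ distinct v ⟧ * G (k ∷ v)))
      ≈⟨ ∑-cong (λ k → ∑ⱽ-fresh k _) ⟩
    ∑ (λ k → ∑ⱽ λ v → ⟦ distinct (Vec.map (punchIn k) v) ⟧ * G (k ∷ Vec.map (punchIn k) v))
      ≈⟨ ∑-cong (λ k → ∑ⱽ-cong λ v → *-congʳ (reflexive (≡.cong ⟦_⟧ (distinct-punchIn k v)))) ⟩
    ∑ (λ k → ∑ᴰ λ v → G (k ∷ Vec.map (punchIn k) v)) ∎

  ∑ᴰ-const : ∀ n → ∑ᴰ {n} {n} (λ _ → 1#) ≈ ι (n !)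
  ∑ᴰ-const zero    = trans (∑ᴰ-[] _) (sym ι-1)
  ∑ᴰ-const (suc n) = trans (∑ᴰ-∷ _) (trans (∑-cong λ k → ∑ᴰ-const n) (trans (∑-const (suc n) _) (sym (ι-* (suc n) (n !)))))

  -- Elementary symmetric functions

  esym : ∀ {n} → ℕ → (Fin n → Carrier) → Carrier
  esym zero            g = 1#
  esym {zero}  (suc i) g = 0#
  esym {suc n} (suc i) g = g zero * esym i (g ∘ suc) + esym (suc i) (g ∘ suc)

  esym-cong : ∀ {n} i {f g : Fin n → Carrier} → (∀ k → f k ≈ g k) → esym i f ≈ esym i g
  esym-cong         zero    h = refl
  esym-cong {zero}  (suc i) h = refl
  esym-cong {suc n} (suc i) h = +-cong (*-cong (h zero) (esym-cong i (h ∘ suc))) (esym-cong (suc i) (h ∘ suc))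

  esym-vanish : ∀ {n i} (g : Fin n → Carrier) → n ℕ.< i → esym i g ≈ 0#
  esym-vanish {zero}  {suc i} g _ = refl
  esym-vanish {suc n} {suc i} g (ℕ.s≤s n<i) = trans
    (+-cong (trans (*-congˡ (esym-vanish (g ∘ suc) n<i)) (zeroʳ _)) (esym-vanish (g ∘ suc) (ℕₚ.m<n⇒m<1+n n<i)))
    (+-identityʳ 0#)

  -- The definition splits off index `zero`; splitting off any other index works equally well
  -- because the two splittings commute. This carries the symmetry of `esym`.
  esym-removeAt : ∀ {n} i (g : Fin (suc n) → Carrier) k →
    esym (suc i) g ≈ g k * esym i (g ∘ punchIn k) + esym (suc i) (g ∘ punchIn k)
  esym-removeAt         i       g zero    = refl
  esym-removeAt {suc n} zero    g (suc k) = begin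
    g zero * 1# + esym 1 (g ∘ suc)
      ≈⟨ +-congˡ (esym-removeAt zero (g ∘ suc) k) ⟩
    g zero * 1# + (g (suc k) * 1# + esym 1 (g ∘ suc ∘ punchIn k))
      ≈⟨ solve 3 (λ a b c → a :+ (b :+ c) := b :+ (a :+ c)) refl _ _ _ ⟩
    g (suc k) * 1# + (g zero * 1# + esym 1 (g ∘ suc ∘ punchIn k)) ∎
  esym-removeAt {suc n} (suc i) g (suc k) = begin
    g zero * esym (suc i) (g ∘ suc) + esym (suc (suc i)) (g ∘ suc)
      ≈⟨ +-cong (*-congˡ (esym-removeAt i (g ∘ suc) k)) (esym-removeAt (suc i) (g ∘ suc) k) ⟩
    g zero * (g (suc k) * esym i h + esym (suc i) h) + (g (suc k) * esym (suc i) h + esym (suc (suc i)) h)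
      ≈⟨ solve 5 (λ a b p q r → a :* (b :* p :+ q) :+ (b :* q :+ r) := b :* (a :* p :+ q) :+ (a :* q :+ r)) refl _ _ _ _ _ ⟩
    g (suc k) * (g zero * esym i h + esym (suc i) h) + (g zero * esym (suc i) h + esym (suc (suc i)) h) ∎
    where h = g ∘ suc ∘ punchIn k

  esym-removeAt-0 : ∀ {n} i (g : Fin (suc n) → Carrier) k → g k ≈ 0# → esym i g ≈ esym i (g ∘ punchIn k)
  esym-removeAt-0 zero    g k h = refl
  esym-removeAt-0 (suc i) g k h = trans (esym-removeAt i g k) (trans (+-congʳ (trans (*-congʳ h) (zeroˡ _))) (+-identityˡ _))

  -- Each monomial of degree i+1 arises once from each of its i+1 factors. This is Euler's identity
  -- for a homogeneous polynomial.
  esym-euler : ∀ {n} i (g : Fin (suc n) → Carrier) →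
    ∑ (λ k → g k * esym i (g ∘ punchIn k)) ≈ ι (suc i) * esym (suc i) g
  esym-euler {zero} i g = begin
    ∑ (λ k → g k * esym i (g ∘ punchIn k))
      ≈⟨ trans (∑-suc _) (+-congˡ (∑-empty _)) ⟩
    g zero * esym i (g ∘ suc) + 0#
      ≈⟨ base i ⟩
    ι (suc i) * esym (suc i) g ∎
    where
    base : ∀ i → g zero * esym i (g ∘ suc) + 0# ≈ ι (suc i) * (g zero * esym i (g ∘ suc) + 0#)
    base zero    = solve 1 (λ a → a :* :1 :+ :0 := (:1 :+ :0) :* (a :* :1 :+ :0)) refl (g zero)
    base (suc i) = solve 2 (λ a n → a :* :0 :+ :0 := (:1 :+ n) :* (a :* :0 :+ :0)) refl (g zero) (ι (suc i))
  esym-euler {suc n} zero g = begin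
    ∑ (λ k → g k * 1#)
      ≈⟨ ∑-suc _ ⟩
    g zero * 1# + ∑ (λ k → g (suc k) * 1#)
      ≈⟨ +-congˡ (esym-euler zero (g ∘ suc)) ⟩
    g zero * 1# + (1# + 0#) * esym 1 (g ∘ suc)
      ≈⟨ solve 2 (λ a b → a :* :1 :+ (:1 :+ :0) :* b := (:1 :+ :0) :* (a :* :1 :+ b)) refl _ _ ⟩
    (1# + 0#) * (g zero * 1# + esym 1 (g ∘ suc)) ∎
  esym-euler {suc n} (suc i) g = begin
    ∑ (λ k → g k * esym (suc i) (g ∘ punchIn k))
      ≈⟨ ∑-suc _ ⟩
    g zero * esym (suc i) g′ + ∑ (λ k → g (suc k) * (g zero * esym i (g′ ∘ punchIn k) + esym (suc i) (g′ ∘ punchIn k)))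
      ≈⟨ +-congˡ (trans (∑-cong λ k → solve 4 (λ b a p q → b :* (a :* p :+ q) := a :* (b :* p) :+ :1 :* (b :* q)) refl _ _ _ _)
           (∑-linear (g zero) 1# _ _)) ⟩
    g zero * esym (suc i) g′ + (g zero * ∑ (λ k → g′ k * esym i (g′ ∘ punchIn k)) + 1# * ∑ (λ k → g′ k * esym (suc i) (g′ ∘ punchIn k)))
      ≈⟨ +-congˡ (+-cong (*-congˡ (esym-euler i g′)) (*-congˡ (esym-euler (suc i) g′))) ⟩
    g zero * esym (suc i) g′ + (g zero * (ι (suc i) * esym (suc i) g′) + 1# * ((1# + ι (suc i)) * esym (suc (suc i)) g′))
      ≈⟨ solve 4 (λ a p n r → a :* p :+ (a :* (n :* p) :+ :1 :* ((:1 :+ n) :* r)) := (:1 :+ n) :* (a :* p :+ r)) refl _ _ _ _ ⟩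
    (1# + ι (suc i)) * (g zero * esym (suc i) g′ + esym (suc (suc i)) g′) ∎
    where g′ = g ∘ suc

  -- A monomial of degree j survives the removal of any index outside it, and there are n+1-j = r+1
  -- of those.
  ∑-esym-removeAt : ∀ {n} j r (g : Fin (suc n) → Carrier) → j ℕ.+ r ≡ n →
    ∑ (λ k → esym j (g ∘ punchIn k)) ≈ ι (suc r) * esym j g
  ∑-esym-removeAt zero    r g ≡.refl = ∑-const (suc r) 1#
  -- Adding the Euler sum to both sides completes each summand to `esym (suc j) g`, which no longer
  -- depends on the removed index.
  ∑-esym-removeAt (suc j) r g ≡.refl = +-cancelʳ (ι (suc j) * esym (suc j) g) _ _ (begin
    ∑ (λ k → esym (suc j) (g ∘ punchIn k)) + ι (suc j) * esym (suc j) g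
      ≈⟨ trans (+-congˡ (sym (esym-euler j g))) (sym (∑-+ _ _)) ⟩
    ∑ (λ k → esym (suc j) (g ∘ punchIn k) + g k * esym j (g ∘ punchIn k))
      ≈⟨ ∑-cong (λ k → trans (+-comm _ _) (sym (esym-removeAt j g k))) ⟩
    ∑ {suc (suc j ℕ.+ r)} (λ _ → esym (suc j) g)
      ≈⟨ ∑-const (suc (suc j ℕ.+ r)) _ ⟩
    ι (suc (suc j ℕ.+ r)) * esym (suc j) g
      ≈⟨ *-congʳ (+-congˡ (ι-+ (suc j) r)) ⟩
    (1# + (ι (suc j) + ι r)) * esym (suc j) g
      ≈⟨ solve 3 (λ a b e → (:1 :+ (a :+ b)) :* e := (:1 :+ b) :* e :+ a :* e) refl _ _ _ ⟩
    ι (suc r) * esym (suc j) g + ι (suc j) * esym (suc j) g ∎)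

  -- Sums over permutations

  select : ∀ {m n} → Vec Bool m → (Fin n → Carrier) → Vec (Fin n) m → Carrier
  select []          g []      = 1#
  select (true  ∷ p) g (k ∷ v) = g k * select p g v
  select (false ∷ p) g (k ∷ v) = select p g v

  select-cong : ∀ {m n} (p : Vec Bool m) {f g : Fin n → Carrier} v → (∀ k → f k ≈ g k) → select p f v ≈ select p g v
  select-cong []          []      h = refl
  select-cong (true  ∷ p) (k ∷ v) h = *-cong (h k) (select-cong p v h)
  select-cong (false ∷ p) (k ∷ v) h = select-cong p v h

  select-map : ∀ {m n q} (p : Vec Bool m) (g : Fin q → Carrier) (f : Fin n → Fin q) v →
    select p g (Vec.map f v) ≡ select p (g ∘ f) v
  select-map []          g f []      = ≡.refl
  select-map (true  ∷ p) g f (k ∷ v) = ≡.cong (g (f k) *_) (select-map p g f v)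
  select-map (false ∷ p) g f (k ∷ v) = select-map p g f v

  select-1 : ∀ {m n} (p : Vec Bool m) (v : Vec (Fin n) m) → select p (λ _ → 1#) v ≈ 1#
  select-1 []          []      = refl
  select-1 (true  ∷ p) (k ∷ v) = trans (*-identityˡ _) (select-1 p v)
  select-1 (false ∷ p) (k ∷ v) = select-1 p v

  untaken : ∀ {m n} → Vec Bool m → Vec (Fin n) m → Fin n → Carrier
  untaken p v l = select p (λ k → ν k l) v

  ν-refl : ∀ {n} (k : Fin n) → ν k k ≈ 0#
  ν-refl k = trans (+-congˡ (-‿cong (reflexive (δ-refl k)))) (-‿inverseʳ 1#)

  ν-≢ : ∀ {n} {k l : Fin n} → k ≢ l → ν k l ≈ 1#
  ν-≢ k≢l = trans (+-congˡ (-‿cong (reflexive (≡.cong ⟦_⟧ (≟-≢ k≢l))))) (solve 0 (:1 :- :0 := :1) refl)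

  ν-punchIn : ∀ {n} (h : Fin (suc n)) k l → ν (punchIn h k) (punchIn h l) ≡ ν k l
  ν-punchIn h k l = ≡.cong (λ b → 1# - ⟦ b ⟧) (≟-inj (punchIn h) (punchIn-injective h _ _) k l)

  untaken-punchIn : ∀ {m n} (p : Vec Bool m) k (v : Vec (Fin n) m) l →
    untaken p (Vec.map (punchIn k) v) (punchIn k l) ≈ untaken p v l
  untaken-punchIn p k v l = trans (reflexive (select-map p _ (punchIn k) v)) (select-cong p v λ h → reflexive (ν-punchIn k h l))

  untaken-hole : ∀ {m n} (p : Vec Bool m) k (v : Vec (Fin n) m) → untaken p (Vec.map (punchIn k) v) k ≈ 1#
  untaken-hole p k v = trans (reflexive (select-map p _ (punchIn k) v))
    (trans (select-cong p v λ h → ν-≢ (punchInᵢ≢i k h)) (select-1 p v))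

  -- For a permutation there are `#false p` untaken labels, so the `esym` factor counts i-subsets of
  -- them; it is what a sum over τ leaves behind. In the induction a marked row gives its label
  -- indicator 0 (`shrink`), and `esym-euler` sums over the label. An unmarked row gives its label
  -- indicator 1 (`split`), whence Pascal's rule, and `∑-esym-removeAt` sums over the label.
  ∑ᴰ-select-esym : ∀ {m} (p : Vec Bool m) i (g : Fin m → Carrier) →
    ∑ᴰ (λ v → select p g v * esym i (untaken p v)) ≈ ι ((#false p C i) ℕ.* (#true p ! ℕ.* #false p !)) * esym (#true p) g
  ∑ᴰ-select-esym [] zero    g = trans (∑ᴰ-[] _) (*-congʳ (sym ι-1))
  ∑ᴰ-select-esym [] (suc i) g = trans (∑ᴰ-[] _) (solve 0 (:1 :* :0 := :0 :* :1) refl)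
  ∑ᴰ-select-esym {suc m} (true ∷ p) i g = begin
    ∑ᴰ (λ v → select (true ∷ p) g v * esym i (untaken (true ∷ p) v))
      ≈⟨ ∑ᴰ-∷ _ ⟩
    ∑ (λ k → ∑ᴰ λ v → (g k * select p g (Vec.map (punchIn k) v)) * esym i (untaken (true ∷ p) (k ∷ Vec.map (punchIn k) v)))
      ≈⟨ ∑-cong (λ k → trans (∑ᴰ-cong λ v → trans (*-cong (*-congˡ (reflexive (select-map p g (punchIn k) v))) (shrink k v)) (*-assoc _ _ _)) (∑ᴰ-*ˡ _ _)) ⟩
    ∑ (λ k → g k * ∑ᴰ λ v → select p (g ∘ punchIn k) v * esym i (untaken p v))
      ≈⟨ ∑-cong (λ k → trans (*-congˡ (∑ᴰ-select-esym p i (g ∘ punchIn k))) (solve 3 (λ a b c → a :* (b :* c) := b :* (a :* c)) refl _ _ _)) ⟩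
    ∑ (λ k → ι N * (g k * esym (#true p) (g ∘ punchIn k)))
      ≈⟨ trans (∑-*ˡ _ _) (*-congˡ (esym-euler (#true p) g)) ⟩
    ι N * (ι (suc (#true p)) * esym (suc (#true p)) g)
      ≈⟨ trans (sym (*-assoc _ _ _)) (*-congʳ (trans (sym (ι-* N (suc (#true p)))) (reflexive (≡.cong ι (arith (#false p C i) (#true p) (#true p !) (#false p !)))))) ⟩
    _ ∎
    where
    N = (#false p C i) ℕ.* (#true p ! ℕ.* #false p !)
    arith : ∀ c t u w → c ℕ.* (u ℕ.* w) ℕ.* suc t ≡ c ℕ.* (suc t ℕ.* u ℕ.* w)
    arith = ℕ-Solver.solve-∀
    shrink : ∀ k v → esym i (untaken (true ∷ p) (k ∷ Vec.map (punchIn k) v)) ≈ esym i (untaken p v)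
    shrink k v = trans (esym-removeAt-0 i _ k (trans (*-congʳ (ν-refl k)) (zeroˡ _)))
      (esym-cong i λ l → trans (*-cong (ν-≢ (punchInᵢ≢i k l ∘ ≡.sym)) (untaken-punchIn p k v l)) (*-identityˡ _))
  ∑ᴰ-select-esym {suc m} (false ∷ p) zero g = begin
    ∑ᴰ (λ v → select (false ∷ p) g v * 1#)
      ≈⟨ ∑ᴰ-∷ _ ⟩
    ∑ (λ k → ∑ᴰ λ v → select p g (Vec.map (punchIn k) v) * 1#)
      ≈⟨ ∑-cong (λ k → trans (∑ᴰ-cong λ v → *-congʳ (reflexive (select-map p g (punchIn k) v))) (∑ᴰ-select-esym p zero (g ∘ punchIn k))) ⟩
    ∑ (λ k → ι N * esym (#true p) (g ∘ punchIn k))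
      ≈⟨ trans (∑-*ˡ _ _) (*-congˡ (∑-esym-removeAt (#true p) (#false p) g (#true+#false p))) ⟩
    ι N * (ι (suc (#false p)) * esym (#true p) g)
      ≈⟨ trans (sym (*-assoc _ _ _)) (*-congʳ (trans (sym (ι-* N (suc (#false p)))) (reflexive (≡.cong ι (arith (#false p) (#true p !) (#false p !)))))) ⟩
    _ ∎
    where
    N = (#false p C 0) ℕ.* (#true p ! ℕ.* #false p !)
    arith : ∀ f u w → 1 ℕ.* (u ℕ.* w) ℕ.* suc f ≡ 1 ℕ.* (u ℕ.* (suc f ℕ.* w))
    arith = ℕ-Solver.solve-∀
  ∑ᴰ-select-esym {suc m} (false ∷ p) (suc i) g = begin
    ∑ᴰ (λ v → select (false ∷ p) g v * esym (suc i) (untaken (false ∷ p) v))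
      ≈⟨ ∑ᴰ-∷ _ ⟩
    ∑ (λ k → ∑ᴰ λ v → select p g (Vec.map (punchIn k) v) * esym (suc i) (untaken p (Vec.map (punchIn k) v)))
      ≈⟨ ∑-cong (λ k → trans (∑ᴰ-cong λ v → trans (*-cong (reflexive (select-map p g (punchIn k) v)) (split k v)) (distribˡ _ _ _)) (∑ᴰ-+ _ _)) ⟩
    ∑ (λ k → ∑ᴰ (λ v → select p (g ∘ punchIn k) v * esym i (untaken p v)) + ∑ᴰ (λ v → select p (g ∘ punchIn k) v * esym (suc i) (untaken p v)))
      ≈⟨ ∑-cong (λ k → trans (+-cong (∑ᴰ-select-esym p i (g ∘ punchIn k)) (∑ᴰ-select-esym p (suc i) (g ∘ punchIn k))) (sym (distribʳ _ _ _))) ⟩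
    ∑ (λ k → (ι N + ι M) * esym (#true p) (g ∘ punchIn k))
      ≈⟨ trans (∑-*ˡ _ _) (*-cong (sym (ι-+ N M)) (∑-esym-removeAt (#true p) (#false p) g (#true+#false p))) ⟩
    ι (N ℕ.+ M) * (ι (suc (#false p)) * esym (#true p) g)
      ≈⟨ trans (sym (*-assoc _ _ _)) (*-congʳ (trans (sym (ι-* (N ℕ.+ M) (suc (#false p)))) (reflexive (≡.cong ι (≡.trans
           (arith (#false p C i) (#false p C suc i) (#false p) (#true p !) (#false p !))
           (≡.cong (ℕ._* (#true p ! ℕ.* (suc (#false p) ℕ.* #false p !))) (nCk+nC[k+1]≡[n+1]C[k+1] (#false p) i))))))) ⟩
    _ ∎
    where
    N = (#false p C i) ℕ.* (#true p ! ℕ.* #false p !)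
    M = (#false p C suc i) ℕ.* (#true p ! ℕ.* #false p !)
    arith : ∀ c d f u w → (c ℕ.* (u ℕ.* w) ℕ.+ d ℕ.* (u ℕ.* w)) ℕ.* suc f ≡ (c ℕ.+ d) ℕ.* (u ℕ.* (suc f ℕ.* w))
    arith = ℕ-Solver.solve-∀
    split : ∀ k v → esym (suc i) (untaken p (Vec.map (punchIn k) v)) ≈ esym i (untaken p v) + esym (suc i) (untaken p v)
    split k v = trans (esym-removeAt i (untaken p (Vec.map (punchIn k) v)) k) (+-cong
      (trans (*-cong (untaken-hole p k v) (esym-cong i (untaken-punchIn p k v))) (*-identityˡ _))
      (esym-cong (suc i) (untaken-punchIn p k v)))

  ∑ᴰ-select : ∀ {m} (p : Vec Bool m) (g : Fin m → Carrier) →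
    ∑ᴰ (select p g) ≈ ι (#true p ! ℕ.* #false p !) * esym (#true p) g
  ∑ᴰ-select p g = trans (∑ᴰ-cong λ v → sym (*-identityʳ _)) (trans (∑ᴰ-select-esym p 0 g)
    (*-congʳ (reflexive (≡.cong ι (ℕₚ.*-identityˡ (#true p ! ℕ.* #false p !))))))

  -- Weighted matchings of rows to labels

  opaque
    ∑ᶜ : ∀ {m} → (Vec Choice m → Carrier) → Carrier
    ∑ᶜ {zero}  F = F []
    ∑ᶜ {suc m} F = ∑ᶜ (λ f → F (none ∷ f)) + (∑ᶜ (λ f → F (viaτ ∷ f)) + ∑ᶜ (λ f → F (viaσ ∷ f)))

    ∑ᶜ-[] : (F : Vec Choice 0 → Carrier) → ∑ᶜ F ≈ F []
    ∑ᶜ-[] F = refl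

    ∑ᶜ-∷ : ∀ {m} (F : Vec Choice (suc m) → Carrier) →
      ∑ᶜ F ≈ ∑ᶜ (λ f → F (none ∷ f)) + (∑ᶜ (λ f → F (viaτ ∷ f)) + ∑ᶜ (λ f → F (viaσ ∷ f)))
    ∑ᶜ-∷ F = refl

    ∑ᶜ-cong : ∀ {m} {F G : Vec Choice m → Carrier} → (∀ f → F f ≈ G f) → ∑ᶜ F ≈ ∑ᶜ G
    ∑ᶜ-cong {zero}  h = h []
    ∑ᶜ-cong {suc m} h = +-cong (∑ᶜ-cong λ f → h (none ∷ f)) (+-cong (∑ᶜ-cong λ f → h (viaτ ∷ f)) (∑ᶜ-cong λ f → h (viaσ ∷ f)))

    ∑ᶜ-*ˡ : ∀ {m} x (F : Vec Choice m → Carrier) → ∑ᶜ (λ f → x * F f) ≈ x * ∑ᶜ F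
    ∑ᶜ-*ˡ {zero}  x F = refl
    ∑ᶜ-*ˡ {suc m} x F = trans
      (+-cong (∑ᶜ-*ˡ x λ f → F (none ∷ f)) (+-cong (∑ᶜ-*ˡ x λ f → F (viaτ ∷ f)) (∑ᶜ-*ˡ x λ f → F (viaσ ∷ f))))
      (solve 4 (λ x a b c → x :* a :+ (x :* b :+ x :* c) := x :* (a :+ (b :+ c))) refl _ _ _ _)

    ∑ᴰ-∑ᶜ : ∀ {m p n} (G : Vec Choice m → Vec (Fin n) p → Carrier) →
      ∑ᴰ (λ v → ∑ᶜ λ f → G f v) ≈ ∑ᶜ (λ f → ∑ᴰ (G f))
    ∑ᴰ-∑ᶜ {zero}  G = refl
    ∑ᴰ-∑ᶜ {suc m} G = trans (∑ᴰ-+ _ _) (+-cong (∑ᴰ-∑ᶜ λ f → G (none ∷ f))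
      (trans (∑ᴰ-+ _ _) (+-cong (∑ᴰ-∑ᶜ λ f → G (viaτ ∷ f)) (∑ᴰ-∑ᶜ λ f → G (viaσ ∷ f)))))

  select-* : ∀ {m n} (p : Vec Bool m) (f g : Fin n → Carrier) v → select p (λ l → f l * g l) v ≈ select p f v * select p g v
  select-* []          f g []      = sym (*-identityˡ _)
  select-* (true  ∷ p) f g (k ∷ v) = trans (*-congˡ (select-* p f g v))
    (solve 4 (λ a b c d → (a :* b) :* (c :* d) := (a :* c) :* (b :* d)) refl _ _ _ _)
  select-* (false ∷ p) f g (k ∷ v) = select-* p f g v

  ν-false : ∀ {n} {k l : Fin n} → not ⌊ k ≟ᶠ l ⌋ ≡ true → ν k l ≈ 1#
  ν-false {k = k} {l} h with k ≟ᶠ l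
  ... | no _ = solve 0 (:1 :- :0 := :1) refl

  ν-sym : ∀ {n} (k l : Fin n) → ν k l ≈ ν l k
  ν-sym k l with k ≟ᶠ l
  ... | yes ≡.refl = +-congˡ (-‿cong (sym (reflexive (δ-refl k))))
  ... | no k≢l     = trans (solve 0 (:1 :- :0 := :1) refl) (sym (ν-≢ (k≢l ∘ ≡.sym)))

  select-fresh : ∀ {m n} (p : Vec Bool m) k (v : Vec (Fin n) m) → fresh k v ≡ true → select p (ν k) v ≈ 1#
  select-fresh []          k []      h = refl
  select-fresh (true  ∷ p) k (l ∷ v) h = let h₁ , h₂ = ∧-true h in
    trans (*-cong (ν-false h₁) (select-fresh p k v h₂)) (*-identityˡ _)
  select-fresh (false ∷ p) k (l ∷ v) h = let h₁ , h₂ = ∧-true h in select-fresh p k v h₂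

  select-∖-fresh : ∀ {m n} (p : Vec Bool m) (χ : Fin n → Carrier) k v → fresh k v ≡ true →
    select p (χ ∖ k) v ≈ select p χ v
  select-∖-fresh p χ k v h = trans (select-* p (ν k) χ v) (trans (*-congʳ (select-fresh p k v h)) (*-identityˡ _))

  -- With U = τ-rows f and V = σ-rows f, the last factor tests τ(U) ∩ σ(V) = ∅.
  place : ∀ {m n} → (Fin n → Carrier) → (Fin n → Carrier) → Vec Choice m → Vec (Fin n) m → Vec (Fin n) m → Carrier
  place b χ f τ σ = (select (σ-rows f) b σ * select (σ-rows f) χ σ)
    * (select (τ-rows f) χ τ * select (τ-rows f) (untaken (σ-rows f) σ) τ)

  -- Deleting `k` from the weights has no effect on the τ-rows, since `τ` avoids `k` already. On the
  -- σ-rows it demands that `k` is not in σ(V), which is the disjointness test for the new row.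
  place-viaτ : ∀ {m n} (b χ : Fin n → Carrier) f k l (τ σ : Vec (Fin n) m) → fresh k τ ≡ true →
    place b χ (viaτ ∷ f) (k ∷ τ) (l ∷ σ) ≈ χ k * place b (χ ∖ k) f τ σ
  place-viaτ b χ f k l τ σ h = sym (begin
    χ k * ((select R b σ * select R (χ ∖ k) σ) * (select L (χ ∖ k) τ * select L (untaken R σ) τ))
      ≈⟨ *-congˡ (*-cong (*-congˡ (trans (select-* R (ν k) χ σ) (*-congʳ (select-cong R σ λ h → ν-sym k h))))
                         (*-congʳ (select-∖-fresh L χ k τ h))) ⟩
    χ k * ((select R b σ * (untaken R σ k * select R χ σ)) * (select L χ τ * select L (untaken R σ) τ))
      ≈⟨ solve 6 (λ c p u q r s → c :* ((p :* (u :* q)) :* (r :* s)) := (p :* q) :* ((c :* r) :* (u :* s))) refl _ _ _ _ _ _ ⟩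
    (select R b σ * select R χ σ) * ((χ k * select L χ τ) * (untaken R σ k * select L (untaken R σ) τ)) ∎)
    where
    L = τ-rows f
    R = σ-rows f

  -- The mirror image: `σ` avoids `l` already, and on the τ-rows the deletion becomes the factor by
  -- which the new row enlarges the set of taken labels.
  place-viaσ : ∀ {m n} (b χ : Fin n → Carrier) f k l (τ σ : Vec (Fin n) m) → fresh l σ ≡ true →
    place b χ (viaσ ∷ f) (k ∷ τ) (l ∷ σ) ≈ (b l * χ l) * place b (χ ∖ l) f τ σ
  place-viaσ b χ f k l τ σ h = begin
    ((b l * select R b σ) * (χ l * select R χ σ)) * (select L χ τ * select L (λ h → ν l h * untaken R σ h) τ)
      ≈⟨ *-congˡ (*-congˡ (select-* L (ν l) (untaken R σ) τ)) ⟩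
    ((b l * select R b σ) * (χ l * select R χ σ)) * (select L χ τ * (select L (ν l) τ * select L (untaken R σ) τ))
      ≈⟨ solve 7 (λ b p c q r u s → ((b :* p) :* (c :* q)) :* (r :* (u :* s)) := (b :* c) :* ((p :* q) :* ((u :* r) :* s))) refl _ _ _ _ _ _ _ ⟩
    (b l * χ l) * ((select R b σ * select R χ σ) * ((select L (ν l) τ * select L χ τ) * select L (untaken R σ) τ))
      ≈⟨ *-congˡ (*-cong (*-congˡ (sym (select-∖-fresh R χ l σ h))) (*-congʳ (sym (select-* L (ν l) χ τ)))) ⟩
    (b l * χ l) * ((select R b σ * select R (χ ∖ l) σ) * (select L (χ ∖ l) τ * select L (untaken R σ) τ)) ∎
    where
    L = τ-rows f
    R = σ-rows f

  -- For fixed `σ` the sum over `τ` is a permutation sum whose weights are the indicator of the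
  -- labels outside σ(V). It leaves an `esym` of that indicator, which the sum over `σ` then
  -- absorbs.
  ∑ᴰ-place : ∀ {m} (b : Fin m → Carrier) (f : Vec Choice m) →
    ∑ᴰ (λ σ → ∑ᴰ λ τ → place b (λ _ → 1#) f τ σ) ≈
      ι ((#true (τ-rows f) ! ℕ.* #false (τ-rows f) !) ℕ.* ((#false (σ-rows f) C #true (τ-rows f)) ℕ.* (#true (σ-rows f) ! ℕ.* #false (σ-rows f) !)))
        * esym (#true (σ-rows f)) b
  ∑ᴰ-place b f = begin
    ∑ᴰ (λ σ → ∑ᴰ λ τ → place b (λ _ → 1#) f τ σ)
      ≈⟨ ∑ᴰ-cong (λ σ → trans (∑ᴰ-cong λ τ → *-cong (trans (*-congˡ (select-1 R σ)) (*-identityʳ _)) (trans (*-congʳ (select-1 L τ)) (*-identityˡ _)))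
           (trans (∑ᴰ-*ˡ _ _) (*-congˡ (∑ᴰ-select L (untaken R σ))))) ⟩
    ∑ᴰ (λ σ → select R b σ * (ι (#true L ! ℕ.* #false L !) * esym (#true L) (untaken R σ)))
      ≈⟨ trans (∑ᴰ-cong λ σ → solve 3 (λ a b c → a :* (b :* c) := b :* (a :* c)) refl _ _ _) (∑ᴰ-*ˡ _ _) ⟩
    ι (#true L ! ℕ.* #false L !) * ∑ᴰ (λ σ → select R b σ * esym (#true L) (untaken R σ))
      ≈⟨ *-congˡ (∑ᴰ-select-esym R (#true L) b) ⟩
    ι (#true L ! ℕ.* #false L !) * (ι ((#false R C #true L) ℕ.* (#true R ! ℕ.* #false R !)) * esym (#true R) b)
      ≈⟨ trans (sym (*-assoc _ _ _)) (*-congʳ (sym (ι-* (#true L ! ℕ.* #false L !) _))) ⟩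
    _ ∎
    where
    L = τ-rows f
    R = σ-rows f

  rows : ∀ {m n} → (Fin m → Carrier) → Vec (Fin n) m → (Fin n → Carrier) → Vec (Fin n) m → Vec (Fin 2) m → Array m n
  rows α τ β σ s i = twoPoint (α i) (Vec.lookup τ i) (sgn Q (Vec.lookup s i) * β (Vec.lookup σ i)) (Vec.lookup σ i)

  module _ (x : Carrier) where

    -- The part of a matching's weight that depends on rows alone and is therefore constant under
    -- sums over τ and σ. The weights `b` belong to labels and sit in `place`, so a row matched
    -- through σ contributes only its sign here.
    coef : ∀ {m} → (Fin m → Carrier) → Vec Choice m → Carrier
    coef a []         = 1#
    coef a (none ∷ f) = x * coef (a ∘ suc) f
    coef a (viaτ ∷ f) = - (a zero * coef (a ∘ suc) f)
    coef a (viaσ ∷ f) = - coef (a ∘ suc) f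

    coef-cong : ∀ {m} {a b : Fin m → Carrier} f → (∀ i → a i ≈ b i) → coef a f ≈ coef b f
    coef-cong []         h = refl
    coef-cong (none ∷ f) h = *-congˡ (coef-cong f (h ∘ suc))
    coef-cong (viaτ ∷ f) h = -‿cong (*-cong (h zero) (coef-cong f (h ∘ suc)))
    coef-cong (viaσ ∷ f) h = -‿cong (coef-cong f (h ∘ suc))

    matchings : ∀ {m n} → (Fin m → Carrier) → (Fin n → Carrier) → (Fin n → Carrier) → Vec (Fin n) m → Vec (Fin n) m → Carrier
    matchings a b χ τ σ = ∑ᶜ λ f → coef a f * place b χ f τ σ

    -- Except for the factor `ι 2`, this is the recursion of `det-gram-±∷`. Freshness lets a deleted
    -- label act on the remaining rows exactly as an occupied one.
    matchings-∷ : ∀ {m n} a (b χ : Fin n → Carrier) k l (τ σ : Vec (Fin n) m) → fresh k τ ≡ true → fresh l σ ≡ true →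
      matchings a b χ (k ∷ τ) (l ∷ σ) ≈
        x * matchings (a ∘ suc) b χ τ σ - a zero * (χ k * matchings (a ∘ suc) b (χ ∖ k) τ σ)
          - b l * (χ l * matchings (a ∘ suc) b (χ ∖ l) τ σ)
    matchings-∷ a b χ k l τ σ hτ hσ = begin
      matchings a b χ (k ∷ τ) (l ∷ σ)
        ≈⟨ ∑ᶜ-∷ _ ⟩
      ∑ᶜ (λ f → (x * coef a′ f) * place b χ f τ σ)
        + (∑ᶜ (λ f → - (a zero * coef a′ f) * place b χ (viaτ ∷ f) (k ∷ τ) (l ∷ σ))
        + ∑ᶜ (λ f → - coef a′ f * place b χ (viaσ ∷ f) (k ∷ τ) (l ∷ σ)))
        ≈⟨ +-cong (trans (∑ᶜ-cong λ f → *-assoc _ _ _) (∑ᶜ-*ˡ x _))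
            (+-cong (trans (∑ᶜ-cong λ f → trans (*-congˡ (place-viaτ b χ f k l τ σ hτ))
                       (solve 4 (λ a c h p → :- (a :* c) :* (h :* p) := :- (a :* h) :* (c :* p)) refl _ _ _ _)) (∑ᶜ-*ˡ _ _))
                    (trans (∑ᶜ-cong λ f → trans (*-congˡ (place-viaσ b χ f k l τ σ hσ))
                       (solve 4 (λ a c h p → :- c :* ((a :* h) :* p) := :- (a :* h) :* (c :* p)) refl _ _ _ _)) (∑ᶜ-*ˡ _ _))) ⟩
      x * M₀ + (- (a zero * χ k) * M₁ + - (b l * χ l) * M₂)
        ≈⟨ solve 7 (λ y a h p b g q → y :+ (:- (a :* h) :* p :+ :- (b :* g) :* q) := y :- a :* (h :* p) :- b :* (g :* q)) refl _ _ _ _ _ _ _ ⟩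
      x * M₀ - a zero * (χ k * M₁) - b l * (χ l * M₂) ∎
      where
      a′ = a ∘ suc
      M₀ = matchings a′ b χ τ σ
      M₁ = matchings a′ b (χ ∖ k) τ σ
      M₂ = matchings a′ b (χ ∖ l) τ σ

    gram-cong : ∀ {m n} (χ : Fin n → Carrier) {N N′ : Array m n} → (∀ i l → N i l ≈ N′ i l) → ∀ i j → gram x χ N i j ≈ gram x χ N′ i j
    gram-cong χ h i j = +-congˡ (-‿cong (∑-cong λ l → *-congˡ (*-cong (h i l) (h j l))))

    -- The weights are general because the induction hypothesis is needed for `χ` and for both of
    -- its deletions. Each row contributes a factor 2 from its two signs.
    ∑ⱽ-det-gram : ∀ {m n} (χ : Fin n → Carrier) (α : Fin m → Carrier) (β : Fin n → Carrier) (τ σ : Vec (Fin n) m) →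
      distinct τ ≡ true → distinct σ ≡ true →
      ∑ⱽ (λ s → Det (gram x χ (rows α τ β σ s))) ≈
        pow (ι 2) m * matchings (λ i → α i * α i) (λ l → β l * β l) χ τ σ
    ∑ⱽ-det-gram χ α β [] [] hτ hσ = begin
      ∑ⱽ (λ s → Det (gram x χ (rows α [] β [] s)))          ≈⟨ ∑ⱽ-[] _ ⟩
      Det (gram x χ (rows α [] β [] []))                    ≈⟨ det-empty _ ⟩
      1#                                                    ≈⟨ solve 0 (:1 := :1 :* (:1 :* ((:1 :* :1) :* (:1 :* :1)))) refl ⟩
      1# * (1# * ((1# * 1#) * (1# * 1#)))                   ≈⟨ *-congˡ (sym (∑ᶜ-[] _)) ⟩
      1# * matchings (λ i → α i * α i) (λ l → β l * β l) χ [] [] ∎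
    ∑ⱽ-det-gram {suc m} {n} χ α β (k ∷ τ) (l ∷ σ) hτ hσ = let hk , hτ′ = ∧-true hτ ; hl , hσ′ = ∧-true hσ in begin
      ∑ⱽ (λ s → Det (gram x χ (rows α (k ∷ τ) β (l ∷ σ) s)))
        ≈⟨ trans (∑ⱽ-∷ _) (trans (∑-suc _) (+-congˡ (trans (∑-suc _) (trans (+-congˡ (∑-empty _)) (+-identityʳ _))))) ⟩
      ∑ⱽ (λ s → Det (gram x χ (rows α (k ∷ τ) β (l ∷ σ) (zero ∷ s)))) + ∑ⱽ (λ s → Det (gram x χ (rows α (k ∷ τ) β (l ∷ σ) (suc zero ∷ s))))
        ≈⟨ sym (∑ⱽ-+ _ _) ⟩
      ∑ⱽ (λ s → Det (gram x χ (rows α (k ∷ τ) β (l ∷ σ) (zero ∷ s))) + Det (gram x χ (rows α (k ∷ τ) β (l ∷ σ) (suc zero ∷ s))))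
        ≈⟨ ∑ⱽ-cong (λ s → trans (+-cong (det-cong (gram-cong χ (plus s))) (det-cong (gram-cong χ (minus s))))
             (trans (det-gram-±∷ x χ (α zero) k (β l) l (N s))
             (solve 9 (λ t x d a h p b g q → t :* (x :* d :- a :* (h :* p) :- b :* (g :* q))
                 := (t :* x) :* d :+ (:- (t :* (a :* h)) :* p :+ :- (t :* (b :* g)) :* q)) refl (ι 2) x _ _ _ _ _ _ _))) ⟩
      ∑ⱽ (λ s → c₀ * Det (gram x χ (N s)) + (c₁ * Det (gram x (χ ∖ k) (N s)) + c₂ * Det (gram x (χ ∖ l) (N s))))
        ≈⟨ trans (∑ⱽ-+ _ _) (+-cong (∑ⱽ-*ˡ _ _) (trans (∑ⱽ-+ _ _) (+-cong (∑ⱽ-*ˡ _ _) (∑ⱽ-*ˡ _ _)))) ⟩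
      c₀ * ∑ⱽ (λ s → Det (gram x χ (N s))) + (c₁ * ∑ⱽ (λ s → Det (gram x (χ ∖ k) (N s))) + c₂ * ∑ⱽ (λ s → Det (gram x (χ ∖ l) (N s))))
        ≈⟨ +-cong (*-congˡ (∑ⱽ-det-gram χ (α ∘ suc) β τ σ hτ′ hσ′))
             (+-cong (*-congˡ (∑ⱽ-det-gram (χ ∖ k) (α ∘ suc) β τ σ hτ′ hσ′)) (*-congˡ (∑ⱽ-det-gram (χ ∖ l) (α ∘ suc) β τ σ hτ′ hσ′))) ⟩
      c₀ * (P * M χ) + (c₁ * (P * M (χ ∖ k)) + c₂ * (P * M (χ ∖ l)))
        ≈⟨ solve 10 (λ t x d a h p b g q w → (t :* x) :* (w :* d) :+ (:- (t :* (a :* h)) :* (w :* p) :+ :- (t :* (b :* g)) :* (w :* q))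
                 := (t :* w) :* (x :* d :- a :* (h :* p) :- b :* (g :* q))) refl (ι 2) x _ _ _ _ _ _ _ P ⟩
      (ι 2 * P) * (x * M χ - α zero * α zero * (χ k * M (χ ∖ k)) - β l * β l * (χ l * M (χ ∖ l)))
        ≈⟨ *-congˡ (sym (matchings-∷ _ _ χ k l τ σ hk hl)) ⟩
      (ι 2 * P) * matchings (λ i → α i * α i) (λ l → β l * β l) χ (k ∷ τ) (l ∷ σ) ∎
      where
      P = pow (ι 2) m
      M = λ χ → matchings (λ i → α (suc i) * α (suc i)) (λ l → β l * β l) χ τ σ
      N = λ s → rows (α ∘ suc) τ β σ s
      c₀ = ι 2 * x
      c₁ = - (ι 2 * (α zero * α zero * χ k))
      c₂ = - (ι 2 * (β l * β l * χ l))
      plus : ∀ s i j → rows α (k ∷ τ) β (l ∷ σ) (zero ∷ s) i j ≈ (twoPoint (α zero) k (β l) l V.∷ N s) i j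
      plus s zero    j = +-congˡ (*-congʳ (*-identityˡ _))
      plus s (suc i) j = refl
      minus : ∀ s i j → rows α (k ∷ τ) β (l ∷ σ) (suc zero ∷ s) i j ≈ (twoPoint (α zero) k (- β l) l V.∷ N s) i j
      minus s zero    j = +-congˡ (*-congʳ (solve 1 (λ b → :- :1 :* b := :- b) refl (β l)))
      minus s (suc i) j = refl

  -- Sums over degrees

  opaque
    ∑≤ : ℕ → (ℕ → Carrier) → Carrier
    ∑≤ = Σ≤ Q

    Σ≤≡∑≤ : ∀ n f → Σ≤ Q n f ≡ ∑≤ n f
    Σ≤≡∑≤ n f = ≡.refl

    ∑≤-zero : ∀ f → ∑≤ 0 f ≈ f 0
    ∑≤-zero f = refl

    ∑≤-last : ∀ n f → ∑≤ (suc n) f ≈ ∑≤ n f + f (suc n)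
    ∑≤-last n f = refl

    ∑≤-cong : ∀ n {f g} → (∀ i → i ≤ n → f i ≈ g i) → ∑≤ n f ≈ ∑≤ n g
    ∑≤-cong zero    h = h 0 ℕₚ.≤-refl
    ∑≤-cong (suc n) h = +-cong (∑≤-cong n λ i i≤n → h i (ℕₚ.m≤n⇒m≤1+n i≤n)) (h (suc n) ℕₚ.≤-refl)

    ∑≤-+ : ∀ n f g → ∑≤ n (λ i → f i + g i) ≈ ∑≤ n f + ∑≤ n g
    ∑≤-+ zero    f g = refl
    ∑≤-+ (suc n) f g = trans (+-congʳ (∑≤-+ n f g)) (solve 4 (λ a b c d → (a :+ b) :+ (c :+ d) := (a :+ c) :+ (b :+ d)) refl _ _ _ _)

    ∑≤-*ˡ : ∀ n x f → ∑≤ n (λ i → x * f i) ≈ x * ∑≤ n f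
    ∑≤-*ˡ zero    x f = refl
    ∑≤-*ˡ (suc n) x f = trans (+-congʳ (∑≤-*ˡ n x f)) (sym (distribˡ _ _ _))

    ∑≤-head : ∀ n f → ∑≤ (suc n) f ≈ f 0 + ∑≤ n (f ∘ suc)
    ∑≤-head zero    f = refl
    ∑≤-head (suc n) f = trans (+-congʳ (∑≤-head n f)) (+-assoc _ _ _)

  ∑≤-neg : ∀ n f → ∑≤ n (λ i → - f i) ≈ - ∑≤ n f
  ∑≤-neg n f = trans (∑≤-cong n λ i _ → solve 1 (λ a → :- a := :- :1 :* a) refl (f i))
    (trans (∑≤-*ˡ n (- 1#) f) (solve 1 (λ a → :- :1 :* a := :- a) refl _))

  ∑≤-triangle : ∀ n (F : ℕ → ℕ → Carrier) →
    ∑≤ n (λ i → ∑≤ (n ∸ i) (F i)) ≈ ∑≤ n (λ k → ∑≤ k (λ i → F i (k ∸ i)))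
  ∑≤-triangle zero    F = trans (∑≤-zero _) (trans (trans (∑≤-zero _) (sym (∑≤-zero _))) (sym (∑≤-zero _)))
  ∑≤-triangle (suc n) F = begin
    ∑≤ (suc n) (λ i → ∑≤ (suc n ∸ i) (F i))
      ≈⟨ ∑≤-last n _ ⟩
    ∑≤ n (λ i → ∑≤ (suc n ∸ i) (F i)) + ∑≤ (n ∸ n) (F (suc n))
      ≈⟨ +-cong (trans (∑≤-cong n λ i i≤n → peel i i≤n) (∑≤-+ n _ _))
           (trans (reflexive (≡.cong (λ k → ∑≤ k (F (suc n))) (ℕₚ.n∸n≡0 n))) (trans (∑≤-zero _) (reflexive (≡.cong (F (suc n)) (≡.sym (ℕₚ.n∸n≡0 n)))))) ⟩
    (∑≤ n (λ i → ∑≤ (n ∸ i) (F i)) + ∑≤ n (λ i → F i (suc n ∸ i))) + F (suc n) (n ∸ n)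
      ≈⟨ trans (+-assoc _ _ _) (+-cong (∑≤-triangle n F) (sym (∑≤-last n _))) ⟩
    ∑≤ n (λ k → ∑≤ k (λ i → F i (k ∸ i))) + ∑≤ (suc n) (λ i → F i (suc n ∸ i))
      ≈⟨ sym (∑≤-last n _) ⟩
    ∑≤ (suc n) (λ k → ∑≤ k (λ i → F i (k ∸ i))) ∎
    where
    peel : ∀ i → i ≤ n → ∑≤ (suc n ∸ i) (F i) ≈ ∑≤ (n ∸ i) (F i) + F i (suc n ∸ i)
    peel i i≤n = trans (reflexive (≡.cong (λ k → ∑≤ k (F i)) (ℕₚ.+-∸-assoc 1 i≤n)))
      (trans (∑≤-last (n ∸ i) (F i)) (+-congˡ (reflexive (≡.cong (F i) (≡.sym (ℕₚ.+-∸-assoc 1 i≤n))))))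

  -- Pascal's rule under the sum. The two parts stand for one further row that stays unmatched or is
  -- matched through σ.
  ∑≤-pascal : ∀ r (u : ℕ → Carrier) →
    ∑≤ (suc r) (λ j → ι (suc r C j) * u j) ≈ ∑≤ r (λ j → ι (r C j) * u j) + ∑≤ r (λ j → ι (r C j) * u (suc j))
  ∑≤-pascal r u = begin
    ∑≤ (suc r) (λ j → ι (suc r C j) * u j)
      ≈⟨ ∑≤-head r _ ⟩
    ι (r C 0) * u 0 + ∑≤ r (λ j → ι (suc r C suc j) * u (suc j))
      ≈⟨ +-congˡ (trans (∑≤-cong r λ j _ → trans (*-congʳ (trans (reflexive (≡.cong ι (≡.sym (nCk+nC[k+1]≡[n+1]C[k+1] r j)))) (ι-+ (r C j) (r C suc j))))
           (distribʳ _ _ _)) (∑≤-+ r _ _)) ⟩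
    ι (r C 0) * u 0 + (∑≤ r (λ j → ι (r C j) * u (suc j)) + ∑≤ r (λ j → ι (r C suc j) * u (suc j)))
      ≈⟨ solve 3 (λ a b c → a :+ (b :+ c) := (a :+ c) :+ b) refl _ _ _ ⟩
    (ι (r C 0) * u 0 + ∑≤ r (λ j → ι (r C suc j) * u (suc j))) + ∑≤ r (λ j → ι (r C j) * u (suc j))
      ≈⟨ +-congʳ (sym (∑≤-head r (λ j → ι (r C j) * u j))) ⟩
    ∑≤ (suc r) (λ j → ι (r C j) * u j) + ∑≤ r (λ j → ι (r C j) * u (suc j))
      -- The extra term at j = r+1 vanishes because C(r, r+1) = 0.
      ≈⟨ +-congʳ (trans (∑≤-last r _) (trans (+-congˡ (trans (*-congʳ (reflexive (≡.cong ι (k>n⇒nCk≡0 (ℕₚ.n<1+n r))))) (zeroˡ _))) (+-identityʳ _))) ⟩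
    ∑≤ r (λ j → ι (r C j) * u j) + ∑≤ r (λ j → ι (r C j) * u (suc j)) ∎

  module _ (x : Carrier) where

    -- The sum over V for a fixed U of size i: of the r rows outside U, j are matched through σ in
    -- `r C j` ways and the other r-j contribute a factor x each.
    distribute : (ℕ → ℕ → Carrier) → ℕ → ℕ → Carrier
    distribute G i r = ∑≤ r λ j → ι (r C j) * (pow x (r ∸ j) * (pow (- 1#) (i ℕ.+ j) * G i j))

    distribute-sucʳ : ∀ G i r → distribute G i (suc r) ≈ x * distribute G i r - distribute (λ i j → G i (suc j)) i r
    distribute-sucʳ G i r = begin
      distribute G i (suc r)
        ≈⟨ ∑≤-pascal r _ ⟩
      ∑≤ r (λ j → ι (r C j) * (pow x (suc r ∸ j) * (pow (- 1#) (i ℕ.+ j) * G i j)))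
        + ∑≤ r (λ j → ι (r C j) * (pow x (r ∸ j) * (pow (- 1#) (i ℕ.+ suc j) * G i (suc j))))
        ≈⟨ +-cong (trans (∑≤-cong r λ j j≤r → trans (*-congˡ (*-congʳ (reflexive (≡.cong (pow x) (ℕₚ.+-∸-assoc 1 j≤r)))))
               (solve 4 (λ b x p g → b :* ((x :* p) :* g) := x :* (b :* (p :* g))) refl _ _ _ _)) (∑≤-*ˡ r x _))
             (trans (∑≤-cong r λ j j≤r → trans (*-congˡ (*-congˡ (*-congʳ (reflexive (≡.cong (pow (- 1#)) (ℕₚ.+-suc i j))))))
               (solve 4 (λ b p s g → b :* (p :* ((:- :1 :* s) :* g)) := :- (b :* (p :* (s :* g)))) refl _ _ _ _)) (∑≤-neg r _)) ⟩
      x * distribute G i r - distribute (λ i j → G i (suc j)) i r ∎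

    distribute-sucˡ : ∀ G i r → distribute G (suc i) r ≈ - distribute (λ i j → G (suc i) j) i r
    distribute-sucˡ G i r = trans (∑≤-cong r λ j _ → solve 4 (λ b p s g → b :* (p :* ((:- :1 :* s) :* g)) := :- (b :* (p :* (s :* g)))) refl _ _ _ _) (∑≤-neg r _)

    -- `G` sees only the sizes of U and V, so U contributes `esym i a` and V a `distribute`. In the
    -- induction, leaving the first row unmatched or matching it through σ enlarges r; matching it
    -- through τ raises i. The recursion of `esym` joins the two contributions.
    ∑ᶜ-coef : ∀ {d} (a : Fin d → Carrier) (G : ℕ → ℕ → Carrier) →
      ∑ᶜ (λ f → coef x a f * G (#true (τ-rows f)) (#true (σ-rows f))) ≈ ∑≤ d (λ i → esym i a * distribute G i (d ∸ i))
    ∑ᶜ-coef {zero} a G = begin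
      ∑ᶜ (λ f → coef x a f * G (#true (τ-rows f)) (#true (σ-rows f))) ≈⟨ ∑ᶜ-[] _ ⟩
      1# * G 0 0                                           ≈⟨ solve 1 (λ g → :1 :* g := :1 :* ((:1 :+ :0) :* (:1 :* (:1 :* g)))) refl _ ⟩
      1# * (ι 1 * (1# * (1# * G 0 0)))                     ≈⟨ *-congˡ (sym (∑≤-zero _)) ⟩
      esym 0 a * distribute G 0 0                                   ≈⟨ sym (∑≤-zero _) ⟩
      ∑≤ 0 (λ i → esym i a * distribute G i (0 ∸ i))                ∎
    ∑ᶜ-coef {suc d} a G = begin
      ∑ᶜ (λ f → coef x a f * G (#true (τ-rows f)) (#true (σ-rows f)))
        ≈⟨ ∑ᶜ-∷ _ ⟩
      ∑ᶜ (λ f → (x * coef x a′ f) * G (#true (τ-rows f)) (#true (σ-rows f)))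
        + (∑ᶜ (λ f → - (a zero * coef x a′ f) * G (suc (#true (τ-rows f))) (#true (σ-rows f)))
        + ∑ᶜ (λ f → - coef x a′ f * G (#true (τ-rows f)) (suc (#true (σ-rows f)))))
        ≈⟨ +-cong (trans (∑ᶜ-cong λ f → *-assoc _ _ _) (trans (∑ᶜ-*ˡ x _) (*-congˡ (∑ᶜ-coef a′ G))))
            (+-cong (trans (∑ᶜ-cong λ f → solve 3 (λ a c g → :- (a :* c) :* g := :- a :* (c :* g)) refl _ _ _) (trans (∑ᶜ-*ˡ _ _) (*-congˡ (∑ᶜ-coef a′ (λ i j → G (suc i) j)))))
                    (trans (∑ᶜ-cong λ f → solve 2 (λ c g → :- c :* g := :- :1 :* (c :* g)) refl _ _) (trans (∑ᶜ-*ˡ _ _) (*-congˡ (∑ᶜ-coef a′ (λ i j → G i (suc j))))))) ⟩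
      x * ∑≤ d (λ i → esym i a′ * distribute G i (d ∸ i))
        + (- a zero * ∑≤ d (λ i → esym i a′ * distribute (λ i j → G (suc i) j) i (d ∸ i))
        + - 1# * ∑≤ d (λ i → esym i a′ * distribute (λ i j → G i (suc j)) i (d ∸ i)))
        ≈⟨ solve 4 (λ p a q r → p :+ (:- a :* q :+ :- :1 :* r) := (p :+ :- :1 :* r) :+ :- a :* q) refl _ _ _ _ ⟩
      (x * ∑≤ d (λ i → esym i a′ * distribute G i (d ∸ i)) + - 1# * ∑≤ d (λ i → esym i a′ * distribute (λ i j → G i (suc j)) i (d ∸ i)))
        + - a zero * ∑≤ d (λ i → esym i a′ * distribute (λ i j → G (suc i) j) i (d ∸ i))
        ≈⟨ +-cong
            (trans (sym (trans (∑≤-+ d _ _) (+-cong (∑≤-*ˡ d x _) (∑≤-*ˡ d (- 1#) _))))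
              (∑≤-cong d λ i i≤d → trans (solve 4 (λ x e p q → x :* (e :* p) :+ :- :1 :* (e :* q) := e :* (x :* p :- q)) refl _ _ _ _)
                (*-congˡ (trans (sym (distribute-sucʳ G i (d ∸ i))) (reflexive (≡.cong (distribute G i) (≡.sym (ℕₚ.+-∸-assoc 1 i≤d))))))))
            (trans (sym (∑≤-*ˡ d (- a zero) _))
              (∑≤-cong d λ i i≤d → trans (solve 3 (λ a e p → :- a :* (e :* p) := (a :* e) :* (:- p)) refl _ _ _)
                (*-congˡ (sym (distribute-sucˡ G i (d ∸ i)))))) ⟩
      ∑≤ d (λ i → esym i a′ * distribute G i (suc d ∸ i)) + ∑≤ d (λ i → (a zero * esym i a′) * distribute G (suc i) (d ∸ i))
        -- The range may be extended to i = d+1, since an elementary symmetric function of degree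
        -- d+1 in d variables is 0.
        ≈⟨ +-congʳ (sym (trans (∑≤-last d _) (trans (+-congˡ (trans (*-congʳ (esym-vanish a′ (ℕₚ.n<1+n d))) (zeroˡ _))) (+-identityʳ _)))) ⟩
      ∑≤ (suc d) (λ i → esym i a′ * distribute G i (suc d ∸ i)) + ∑≤ d (λ i → (a zero * esym i a′) * distribute G (suc i) (d ∸ i))
        ≈⟨ trans (+-congʳ (∑≤-head d _)) (+-assoc _ _ _) ⟩
      1# * distribute G 0 (suc d) + (∑≤ d (λ i → esym (suc i) a′ * distribute G (suc i) (d ∸ i)) + ∑≤ d (λ i → (a zero * esym i a′) * distribute G (suc i) (d ∸ i)))
        ≈⟨ +-congˡ (trans (sym (∑≤-+ d _ _)) (∑≤-cong d λ i _ → trans (sym (distribʳ _ _ _)) (*-congʳ (+-comm _ _)))) ⟩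
      1# * distribute G 0 (suc d) + ∑≤ d (λ i → esym (suc i) a * distribute G (suc i) (d ∸ i))
        ≈⟨ sym (∑≤-head d _) ⟩
      ∑≤ (suc d) (λ i → esym i a * distribute G i (suc d ∸ i)) ∎
      where a′ = a ∘ suc

  -- Sums over lists

  ∑ᴸ : ∀ {a} {A : Set a} → List A → (A → Carrier) → Carrier
  ∑ᴸ xs f = sumL Q (List.map f xs)

  ∑ᴸ-cong : ∀ {a} {A : Set a} (xs : List A) {f g : A → Carrier} → (∀ y → f y ≈ g y) → ∑ᴸ xs f ≈ ∑ᴸ xs g
  ∑ᴸ-cong []       h = refl
  ∑ᴸ-cong (y ∷ xs) h = +-cong (h y) (∑ᴸ-cong xs h)

  ∑ᴸ-++ : ∀ {a} {A : Set a} (xs ys : List A) (f : A → Carrier) → ∑ᴸ (xs List.++ ys) f ≈ ∑ᴸ xs f + ∑ᴸ ys f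
  ∑ᴸ-++ []       ys f = sym (+-identityˡ _)
  ∑ᴸ-++ (y ∷ xs) ys f = trans (+-congˡ (∑ᴸ-++ xs ys f)) (sym (+-assoc _ _ _))

  ∑ᴸ-map : ∀ {a b} {A : Set a} {B : Set b} (g : A → B) (xs : List A) (f : B → Carrier) → ∑ᴸ (List.map g xs) f ≡ ∑ᴸ xs (f ∘ g)
  ∑ᴸ-map g xs f = ≡.cong (sumL Q) (≡.sym (Listₚ.map-∘ xs))

  ∑ᴸ-concatMap : ∀ {a b} {A : Set a} {B : Set b} (g : A → List B) (xs : List A) (f : B → Carrier) →
    ∑ᴸ (List.concatMap g xs) f ≈ ∑ᴸ xs (λ y → ∑ᴸ (g y) f)
  ∑ᴸ-concatMap g []       f = refl
  ∑ᴸ-concatMap g (y ∷ xs) f = trans (∑ᴸ-++ (g y) _ f) (+-congˡ (∑ᴸ-concatMap g xs f))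

  ∑ᴸ-filterᵇ : ∀ {a} {A : Set a} (p : A → Bool) (xs : List A) (f : A → Carrier) →
    ∑ᴸ (List.filterᵇ p xs) f ≈ ∑ᴸ xs (λ y → ⟦ p y ⟧ * f y)
  ∑ᴸ-filterᵇ p []       f = refl
  ∑ᴸ-filterᵇ p (y ∷ xs) f with p y
  ... | true  = +-cong (sym (*-identityˡ _)) (∑ᴸ-filterᵇ p xs f)
  ... | false = trans (∑ᴸ-filterᵇ p xs f) (sym (trans (+-congʳ (zeroˡ _)) (+-identityˡ _)))

  ∑ᴸ-1 : ∀ {a} {A : Set a} (xs : List A) → ∑ᴸ xs (λ _ → 1#) ≈ ι (List.length xs)
  ∑ᴸ-1 []       = refl
  ∑ᴸ-1 (y ∷ xs) = +-congˡ (∑ᴸ-1 xs)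

  -- The hypothesis on `G` stands in for function extensionality: the listed maps and the maps
  -- `lookup v` agree only pointwise.
  ∑ᴸ-allFuns : ∀ m n (G : (Fin m → Fin n) → Carrier) → (∀ {f g} → (∀ i → f i ≡ g i) → G f ≈ G g) →
    ∑ᴸ (allFuns Q m n) G ≈ ∑ⱽ (λ v → G (lookup v))
  ∑ᴸ-allFuns zero n G ext = begin
    G (λ ()) + 0#             ≈⟨ +-identityʳ _ ⟩
    G (λ ())                  ≈⟨ ext (λ ()) ⟩
    G (lookup [])             ≈⟨ sym (∑ⱽ-[] _) ⟩
    ∑ⱽ (λ v → G (lookup v))   ∎
  ∑ᴸ-allFuns (suc m) n G ext = begin
    ∑ᴸ (allFuns Q (suc m) n) G
      ≈⟨ ∑ᴸ-concatMap _ (allFuns Q m n) G ⟩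
    ∑ᴸ (allFuns Q m n) (λ f → ∑ᴸ (List.map (λ k → k V.∷ f) (List.allFin n)) G)
      ≈⟨ ∑ᴸ-cong (allFuns Q m n) (λ f → reflexive (≡.trans (∑ᴸ-map _ (List.allFin n) G) (Σᶠ≡∑ _))) ⟩
    ∑ᴸ (allFuns Q m n) (λ f → ∑ λ k → G (k V.∷ f))
      ≈⟨ ∑ᴸ-allFuns m n (λ f → ∑ λ k → G (k V.∷ f)) (λ h → ∑-cong λ k → ext λ { zero → ≡.refl ; (suc i) → h i }) ⟩
    ∑ⱽ (λ v → ∑ λ k → G (k V.∷ lookup v))
      ≈⟨ ∑ⱽ-∑ (λ k v → G (k V.∷ lookup v)) ⟩
    ∑ (λ k → ∑ⱽ λ v → G (k V.∷ lookup v))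
      ≈⟨ ∑-cong (λ k → ∑ⱽ-cong λ v → ext λ { zero → ≡.refl ; (suc i) → ≡.refl }) ⟩
    ∑ (λ k → ∑ⱽ λ v → G (lookup (k ∷ v)))
      ≈⟨ sym (∑ⱽ-∷ _) ⟩
    ∑ⱽ (λ v → G (lookup v)) ∎

  and-tabulate : ∀ {n} (p : Fin n → Bool) → List.foldr _∧_ true (List.map p (List.allFin n)) ≡ V.foldr _∧_ true p
  and-tabulate {n} p = ≡.trans (≡.cong (List.foldr _∧_ true) (Listₚ.map-tabulate id p)) (go p)
    where
    go : ∀ {n} (p : Fin n → Bool) → List.foldr _∧_ true (List.tabulate p) ≡ V.foldr _∧_ true p
    go {zero}  p = ≡.refl
    go {suc n} p = ≡.cong (p zero ∧_) (go (p ∘ suc))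

  allᵇ-elim : ∀ {n} {p : Fin n → Bool} → allᵇ Q p ≡ true → ∀ i → p i ≡ true
  allᵇ-elim {p = p} h = go (≡.trans (≡.sym (and-tabulate p)) h)
    where
    go : ∀ {n} {p : Fin n → Bool} → V.foldr _∧_ true p ≡ true → ∀ i → p i ≡ true
    go h zero    = proj₁ (∧-true h)
    go {p = p} h (suc i) = go {p = p ∘ suc} (proj₂ (∧-true {a = p zero} h)) i

  allᵇ-intro : ∀ {n} {p : Fin n → Bool} → (∀ i → p i ≡ true) → allᵇ Q p ≡ true
  allᵇ-intro {p = p} h = ≡.trans (and-tabulate p) (go h)
    where
    go : ∀ {n} {p : Fin n → Bool} → (∀ i → p i ≡ true) → V.foldr _∧_ true p ≡ true
    go {zero}  h = ≡.refl
    go {suc n} h = ∧-intro (h zero) (go (h ∘ suc))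

  injective-elim : ∀ {d} {f : Fin d → Fin d} → injective Q f ≡ true → Injective f
  injective-elim {f = f} h {i} {j} = implies-elim (f i ≟ᶠ f j) (i ≟ᶠ j) (allᵇ-elim (allᵇ-elim h i) j)

  injective-intro : ∀ {d} {f : Fin d → Fin d} → Injective f → injective Q f ≡ true
  injective-intro {f = f} h = allᵇ-intro λ i → allᵇ-intro λ j → implies-intro (f i ≟ᶠ f j) (i ≟ᶠ j) h

  injective-cong : ∀ {d} {f g : Fin d → Fin d} → (∀ i → f i ≡ g i) → injective Q f ≡ injective Q g
  injective-cong h = ≡-from-⇔
    (λ k → injective-intro λ e → injective-elim k (≡.trans (h _) (≡.trans e (≡.sym (h _)))))
    (λ k → injective-intro λ e → injective-elim k (≡.trans (≡.sym (h _)) (≡.trans e (h _))))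

  injective≡distinct : ∀ {d} (v : Vec (Fin d) d) → injective Q (lookup v) ≡ distinct v
  injective≡distinct v = ≡-from-⇔ (λ h → distinct-intro v (injective-elim h)) (λ h → injective-intro (distinct-elim v h))

  ∑ᴸ-injective : ∀ {d} (G : (Fin d → Fin d) → Carrier) → (∀ {f g} → (∀ i → f i ≡ g i) → G f ≈ G g) →
    ∑ᴸ (List.filterᵇ (injective Q) (allFuns Q d d)) G ≈ ∑ᴰ (λ v → G (lookup v))
  ∑ᴸ-injective {d} G ext = begin
    ∑ᴸ (List.filterᵇ (injective Q) (allFuns Q d d)) G
      ≈⟨ ∑ᴸ-filterᵇ (injective Q) (allFuns Q d d) G ⟩
    ∑ᴸ (allFuns Q d d) (λ f → ⟦ injective Q f ⟧ * G f)
      ≈⟨ ∑ᴸ-allFuns d d _ (λ h → *-cong (reflexive (≡.cong ⟦_⟧ (injective-cong h))) (ext h)) ⟩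
    ∑ⱽ (λ v → ⟦ injective Q (lookup v) ⟧ * G (lookup v))
      ≈⟨ ∑ⱽ-cong (λ v → *-congʳ (reflexive (≡.cong ⟦_⟧ (injective≡distinct v)))) ⟩
    ∑ᴰ (λ v → G (lookup v)) ∎

  ∑ᴰ-cong′ : ∀ {m n} {F G : Vec (Fin n) m → Carrier} → (∀ v → distinct v ≡ true → F v ≈ G v) → ∑ᴰ F ≈ ∑ᴰ G
  ∑ᴰ-cong′ {F = F} {G} h = ∑ⱽ-cong guarded
    where
    guarded : ∀ v → ⟦ distinct v ⟧ * F v ≈ ⟦ distinct v ⟧ * G v
    guarded v with distinct v in eq
    ... | true  = *-congˡ (h v eq)
    ... | false = trans (zeroˡ _) (sym (zeroˡ _))

  -- A repetition-free vector of full length is a permutation. Relabelling its tail by `unpunch`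
  -- gives an induction that never constructs the inverse permutation.
  ∑-distinct : ∀ {n} (g : Fin n → Carrier) (v : Vec (Fin n) n) → distinct v ≡ true → ∑ (λ i → g (lookup v i)) ≈ ∑ g
  ∑-distinct g []      h = ∑-cong λ ()
  ∑-distinct g (k ∷ v) h with ∧-true {a = fresh k v} h
  ... | hk , hv with unpunch k v hk
  ... | w , ≡.refl = begin
    ∑ (λ i → g (lookup (k ∷ Vec.map (punchIn k) w) i))
      ≈⟨ ∑-suc _ ⟩
    g k + ∑ (λ i → g (lookup (Vec.map (punchIn k) w) i))
      ≈⟨ +-congˡ (∑-cong λ i → reflexive (≡.cong g (lookup-map i (punchIn k) w))) ⟩
    g k + ∑ (λ i → g (punchIn k (lookup w i)))
      ≈⟨ +-congˡ (∑-distinct (g ∘ punchIn k) w (≡.trans (≡.sym (distinct-punchIn k w)) hv)) ⟩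
    g k + ∑ (g ∘ punchIn k)
      ≈⟨ sym (∑-removeAt g k) ⟩
    ∑ g ∎

  -- Elementary symmetric functions as sums of principal minors

  increasing-elim : ∀ {m n} {f : Fin m → Fin n} → increasing Q f ≡ true → Ascending f
  increasing-elim {f = f} h i j = implies-elim (toℕ i ℕ.<? toℕ j) (toℕ (f i) ℕ.<? toℕ (f j)) (allᵇ-elim (allᵇ-elim h i) j)

  increasing-intro : ∀ {m n} {f : Fin m → Fin n} → Ascending f → increasing Q f ≡ true
  increasing-intro {f = f} h = allᵇ-intro λ i → allᵇ-intro λ j → implies-intro (toℕ i ℕ.<? toℕ j) (toℕ (f i) ℕ.<? toℕ (f j)) (h i j)

  increasing-cong : ∀ {m n} {f g : Fin m → Fin n} → (∀ i → f i ≡ g i) → increasing Q f ≡ increasing Q g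
  increasing-cong h = ≡-from-⇔
    (λ k → increasing-intro λ i j i<j → ≡.subst₂ (λ a b → toℕ a < toℕ b) (h i) (h j) (increasing-elim k i j i<j))
    (λ k → increasing-intro λ i j i<j → ≡.subst₂ (λ a b → toℕ a < toℕ b) (≡.sym (h i)) (≡.sym (h j)) (increasing-elim k i j i<j))

  increasing≡ascending : ∀ {m n} (v : Vec (Fin n) m) → increasing Q (lookup v) ≡ ascending v
  increasing≡ascending v = ≡-from-⇔ (λ h → ascending-intro v (increasing-elim h)) (λ h → increasing-intro (ascending-elim v h))

  -- The factor `fresh zero v` comes for free and makes `∑ⱽ-fresh` applicable to sums over ascending
  -- vectors.
  ⟦below⟧ : ∀ {m n} (k : Fin (suc n)) (v : Vec (Fin (suc n)) m) → ⟦ below k v ⟧ ≈ ⟦ fresh zero v ⟧ * ⟦ below k v ⟧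
  ⟦below⟧ k v with below k v in eq
  ... | true  = trans (sym (*-identityʳ _)) (*-congʳ (reflexive (≡.cong ⟦_⟧ (≡.sym (below⇒fresh-zero v eq)))))
  ... | false = sym (zeroʳ _)

  ∏ : ∀ {m n} → (Fin n → Carrier) → Vec (Fin n) m → Carrier
  ∏ g v = V.foldr _*_ 1# (λ i → g (lookup v i))

  ∏-map-suc : ∀ {m n} (g : Fin (suc n) → Carrier) (v : Vec (Fin n) m) → ∏ g (Vec.map suc v) ≡ ∏ (g ∘ suc) v
  ∏-map-suc g []      = ≡.refl
  ∏-map-suc g (k ∷ v) = ≡.cong (g (suc k) *_) (∏-map-suc g v)

  -- The tail comes from the smaller index set through `suc`. Head `zero` yields the first term of
  -- the recursion of `esym`; a head `suc h` yields the ascending vectors of the smaller set.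
  ∑ⱽ-ascending : ∀ k {n} (g : Fin n → Carrier) → ∑ⱽ {k} (λ v → ⟦ ascending v ⟧ * ∏ g v) ≈ esym k g
  ∑ⱽ-ascending zero            g = trans (∑ⱽ-[] _) (*-identityˡ _)
  ∑ⱽ-ascending (suc k) {zero}  g = trans (∑ⱽ-∷ _) (∑-empty _)
  ∑ⱽ-ascending (suc k) {suc n} g = begin
    ∑ⱽ (λ v → ⟦ ascending v ⟧ * ∏ g v)
      ≈⟨ ∑ⱽ-∷ _ ⟩
    ∑ (λ h → ∑ⱽ λ v → ⟦ below h v ∧ ascending v ⟧ * (g h * ∏ g v))
      ≈⟨ ∑-cong (λ h → trans (∑ⱽ-cong λ v → trans (*-congʳ (trans (⟦∧⟧ (below h v) (ascending v)) (*-congʳ (⟦below⟧ h v))))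
           (solve 5 (λ f b a g p → ((f :* b) :* a) :* (g :* p) := f :* (g :* ((b :* a) :* p))) refl _ _ _ _ _)) (∑ⱽ-fresh zero _)) ⟩
    ∑ (λ h → ∑ⱽ λ v → g h * ((⟦ below h (Vec.map suc v) ⟧ * ⟦ ascending (Vec.map suc v) ⟧) * ∏ g (Vec.map suc v)))
      ≈⟨ ∑-suc _ ⟩
    ∑ⱽ (λ v → g zero * ((⟦ below zero (Vec.map suc v) ⟧ * ⟦ ascending (Vec.map suc v) ⟧) * ∏ g (Vec.map suc v)))
      + ∑ (λ h → ∑ⱽ λ v → g (suc h) * ((⟦ below (suc h) (Vec.map suc v) ⟧ * ⟦ ascending (Vec.map suc v) ⟧) * ∏ g (Vec.map suc v)))
      ≈⟨ +-cong
          (trans (∑ⱽ-cong λ v → *-congˡ (*-cong (trans (*-cong (reflexive (≡.cong ⟦_⟧ (below-zero v))) (reflexive (≡.cong ⟦_⟧ (ascending-suc v)))) (*-identityˡ _))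
              (reflexive (∏-map-suc g v)))) (trans (∑ⱽ-*ˡ _ _) (*-congˡ (∑ⱽ-ascending k (g ∘ suc)))))
          (trans (∑-cong λ h → ∑ⱽ-cong λ v → trans (*-congˡ (*-cong
              (trans (*-cong (reflexive (≡.cong ⟦_⟧ (below-suc h v))) (reflexive (≡.cong ⟦_⟧ (ascending-suc v)))) (sym (⟦∧⟧ (below h v) (ascending v))))
              (reflexive (∏-map-suc g v)))) (solve 3 (λ a b c → a :* (b :* c) := b :* (a :* c)) refl _ _ _))
            (trans (sym (∑ⱽ-∷ _)) (∑ⱽ-ascending (suc k) (g ∘ suc)))) ⟩
    g zero * esym k (g ∘ suc) + esym (suc k) (g ∘ suc) ∎

  Σᶠ-cong : ∀ {n} {f g : Fin n → Carrier} → (∀ i → f i ≈ g i) → Σᶠ Q f ≈ Σᶠ Q g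
  Σᶠ-cong {f = f} {g} h = trans (reflexive (Σᶠ≡∑ f)) (trans (∑-cong h) (sym (reflexive (Σᶠ≡∑ g))))

  if-* : ∀ b y → (if b then y else 0#) ≈ ⟦ b ⟧ * y
  if-* true  y = sym (*-identityˡ y)
  if-* false y = sym (zeroˡ y)

  δ-sym : ∀ {n} (i j : Fin n) → δ i j ≈ δ j i
  δ-sym i j with i ≟ᶠ j
  ... | yes ≡.refl = sym (reflexive (δ-refl i))
  ... | no i≢j     = sym (reflexive (≡.cong ⟦_⟧ (≟-≢ (i≢j ∘ ≡.sym))))

  diag-gram : ∀ {d} (a : Fin d → Carrier) i j → (_⊗_ Q (diag Q a) (_ᵀ Q (diag Q a))) i j ≈ δ i j * (a i * a i)
  diag-gram a i j = begin
    Σᶠ Q (λ k → diag Q a i k * diag Q a j k)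
      ≈⟨ reflexive (Σᶠ≡∑ (λ k → diag Q a i k * diag Q a j k)) ⟩
    ∑ (λ k → diag Q a i k * diag Q a j k)
      ≈⟨ ∑-cong (λ k → trans (*-cong (if-* ⌊ i ≟ᶠ k ⌋ (a i)) (if-* ⌊ j ≟ᶠ k ⌋ (a j))) (*-assoc _ _ _)) ⟩
    ∑ (λ k → δ i k * (a i * (δ j k * a j)))
      ≈⟨ ∑-δ i _ ⟩
    a i * (δ j i * a j)
      ≈⟨ case ⟩
    δ i j * (a i * a i) ∎
    where
    case : a i * (δ j i * a j) ≈ δ i j * (a i * a i)
    case with i ≟ᶠ j
    ... | yes ≡.refl = trans (*-congˡ (*-congʳ (reflexive (δ-refl i)))) (solve 1 (λ a → a :* (:1 :* a) := :1 :* (a :* a)) refl (a i))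
    ... | no i≢j     = trans (*-congˡ (*-congʳ (reflexive (≡.cong ⟦_⟧ (≟-≢ (i≢j ∘ ≡.sym))))))
                         (solve 2 (λ a b → a :* (:0 :* b) := :0 :* (a :* a)) refl (a i) (a j))

  -- An increasing map is injective, so the principal submatrix that it selects from a diagonal
  -- matrix is again diagonal.
  e-diag : ∀ {d} k (a : Fin d → Carrier) → e Q k (_⊗_ Q (diag Q a) (_ᵀ Q (diag Q a))) ≈ esym k (λ i → a i * a i)
  e-diag {d} k a = begin
    ∑ᴸ (List.filterᵇ (increasing Q) (allFuns Q k d)) (λ f → det Q (λ p q → M (f p) (f q)))
      ≈⟨ ∑ᴸ-cong (List.filterᵇ (increasing Q) (allFuns Q k d)) (λ f → reflexive (≡.sym (Det≡det (λ p q → M (f p) (f q))))) ⟩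
    ∑ᴸ (List.filterᵇ (increasing Q) (allFuns Q k d)) G
      ≈⟨ ∑ᴸ-filterᵇ (increasing Q) (allFuns Q k d) G ⟩
    ∑ᴸ (allFuns Q k d) (λ f → ⟦ increasing Q f ⟧ * G f)
      ≈⟨ ∑ᴸ-allFuns k d (λ f → ⟦ increasing Q f ⟧ * G f) (λ h → *-cong (reflexive (≡.cong ⟦_⟧ (increasing-cong h)))
           (det-cong λ p q → reflexive (≡.cong₂ M (h p) (h q)))) ⟩
    ∑ⱽ (λ v → ⟦ increasing Q (lookup v) ⟧ * G (lookup v))
      ≈⟨ ∑ⱽ-cong (λ v → trans (*-congʳ (reflexive (≡.cong ⟦_⟧ (increasing≡ascending v)))) (guarded v)) ⟩
    ∑ⱽ (λ v → ⟦ ascending v ⟧ * ∏ (λ i → a i * a i) v)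
      ≈⟨ ∑ⱽ-ascending k _ ⟩
    esym k (λ i → a i * a i) ∎
    where
    M = _⊗_ Q (diag Q a) (_ᵀ Q (diag Q a))
    G : (Fin k → Fin d) → Carrier
    G f = Det (λ p q → M (f p) (f q))
    guarded : ∀ v → ⟦ ascending v ⟧ * G (lookup v) ≈ ⟦ ascending v ⟧ * ∏ (λ i → a i * a i) v
    guarded v with ascending v in eq
    ... | true  = *-congˡ (det-diagonal _ _ λ p q → trans (diag-gram a (lookup v p) (lookup v q))
                    (*-congʳ (reflexive (≡.cong ⟦_⟧ (≟-inj (lookup v) (ascending⇒injective (ascending-elim v eq)) p q)))))
    ... | false = trans (zeroˡ _) (sym (zeroˡ _))

  -- Averages over signed permutation matrices

  sgn² : ∀ t → sgn Q t * sgn Q t ≈ 1#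
  sgn² zero       = *-identityˡ 1#
  sgn² (suc zero) = solve 0 ((:- :1) :* (:- :1) := :1) refl

  signedPerm : ∀ {d} → Vec (Fin 2) d → Vec (Fin d) d → Mat Q d
  signedPerm s σ i j = if ⌊ lookup σ i ≟ᶠ j ⌋ then sgn Q (lookup s i) else 0#

  ∑ᴸ-signedPerms : ∀ d (G : Mat Q d → Carrier) → (∀ {P P′} → (∀ i j → P i j ≡ P′ i j) → G P ≈ G P′) →
    ∑ᴸ (signedPerms Q d) G ≈ ∑ⱽ (λ s → ∑ᴰ λ σ → G (signedPerm s σ))
  ∑ᴸ-signedPerms d G ext = begin
    ∑ᴸ (signedPerms Q d) G
      ≈⟨ ∑ᴸ-concatMap _ (allFuns Q d 2) G ⟩
    ∑ᴸ (allFuns Q d 2) (λ s → ∑ᴸ (List.map (mat s) perms) G)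
      ≈⟨ ∑ᴸ-cong (allFuns Q d 2) (λ s → trans (reflexive (∑ᴸ-map (mat s) perms G)) (∑ᴸ-injective (G ∘ mat s) (λ h → ext (mat-cong {s} (λ _ → ≡.refl) h)))) ⟩
    ∑ᴸ (allFuns Q d 2) (λ s → ∑ᴰ λ σ → G (mat s (lookup σ)))
      ≈⟨ ∑ᴸ-allFuns d 2 (λ s → ∑ᴰ λ σ → G (mat s (lookup σ))) (λ h → ∑ᴰ-cong λ σ → ext (mat-cong h (λ _ → ≡.refl))) ⟩
    ∑ⱽ (λ s → ∑ᴰ λ σ → G (signedPerm s σ)) ∎
    where
    perms = List.filterᵇ (injective Q) (allFuns Q d d)
    mat : (Fin d → Fin 2) → (Fin d → Fin d) → Mat Q d
    mat s σ i j = if ⌊ σ i ≟ᶠ j ⌋ then sgn Q (s i) else 0#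
    mat-cong : ∀ {s s′ σ σ′} → (∀ i → s i ≡ s′ i) → (∀ i → σ i ≡ σ′ i) → ∀ i j → mat s σ i j ≡ mat s′ σ′ i j
    mat-cong hs hσ i j = ≡.cong₂ (λ k t → if ⌊ k ≟ᶠ j ⌋ then sgn Q t else 0#) (hσ i) (hs i)

  module _ {d : ℕ} (a b : Fin d → Carrier) (x : Carrier) where

    sumMat : Mat Q d → Mat Q d → Mat Q d
    sumMat P S = _⊕_ Q (diag Q a) (_⊗_ Q P (_⊗_ Q (diag Q b) (_ᵀ Q S)))

    charDet : Mat Q d → Mat Q d → Carrier
    charDet P S = det Q (_⊖_ Q (_·_ Q x (I Q)) (_⊗_ Q (sumMat P S) (_ᵀ Q (sumMat P S))))

    sumMat-cong : ∀ {P P′ S S′} → (∀ i j → P i j ≡ P′ i j) → (∀ i j → S i j ≡ S′ i j) → ∀ i j → sumMat P S i j ≈ sumMat P′ S′ i j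
    sumMat-cong hP hS i j = +-congˡ (Σᶠ-cong λ k → *-cong (reflexive (hP i k)) (Σᶠ-cong λ l → *-congˡ (reflexive (hS j l))))

    charDet-cong : ∀ {P P′ S S′} → (∀ i j → P i j ≡ P′ i j) → (∀ i j → S i j ≡ S′ i j) → charDet P S ≈ charDet P′ S′
    charDet-cong hP hS = trans (reflexive (≡.sym (Det≡det _))) (trans (det-cong λ i j →
        +-congˡ (-‿cong (Σᶠ-cong λ k → *-cong (sumMat-cong hP hS i k) (sumMat-cong hP hS j k))))
      (reflexive (Det≡det _)))

    signed : Vec (Fin 2) d → Fin d → Carrier
    signed t i = sgn Q (lookup t i) * a i

    -- Multiplying column k by the sign t k and relabelling it τ k turns A + P B Sᵀ
    -- into a matrix whose row i is supported on the labels τ i and σ i.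
    sumMat-rows : ∀ s t (τ σ : Vec (Fin d) d) → distinct τ ≡ true → ∀ i k →
      sumMat (signedPerm s σ) (signedPerm t τ) i k ≈ sgn Q (lookup t k) * rows (signed t) τ b σ s i (lookup τ k)
    sumMat-rows s t τ σ hτ i k = begin
      diag Q a i k + Σᶠ Q (λ p → P i p * Σᶠ Q (λ q → diag Q b p q * S k q))
        ≈⟨ +-cong (if-* ⌊ i ≟ᶠ k ⌋ (a i)) (trans (reflexive (Σᶠ≡∑ _)) (∑-cong λ p → *-cong (if-* ⌊ lookup σ i ≟ᶠ p ⌋ sᵢ) (reflexive (Σᶠ≡∑ _)))) ⟩
      δ i k * a i + ∑ (λ p → (δ (lookup σ i) p * sᵢ) * ∑ (λ q → diag Q b p q * S k q))
        ≈⟨ +-congˡ (trans (∑-cong λ p → *-assoc _ _ _) (∑-δ (lookup σ i) _)) ⟩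
      δ i k * a i + sᵢ * ∑ (λ q → diag Q b (lookup σ i) q * S k q)
        ≈⟨ +-congˡ (*-congˡ (trans (∑-cong λ q → trans (*-cong (if-* ⌊ lookup σ i ≟ᶠ q ⌋ (b (lookup σ i))) (if-* ⌊ lookup τ k ≟ᶠ q ⌋ tₖ)) (*-assoc _ _ _)) (∑-δ (lookup σ i) _))) ⟩
      δ i k * a i + sᵢ * (b (lookup σ i) * (δ (lookup τ k) (lookup σ i) * tₖ))
        ≈⟨ +-cong (*-congʳ sign-square) (*-congˡ (*-congˡ (*-congʳ (δ-sym (lookup τ k) (lookup σ i))))) ⟩
      (tₖ * (tᵢ * δ i k)) * a i + sᵢ * (b (lookup σ i) * (δ (lookup σ i) (lookup τ k) * tₖ))
        ≈⟨ solve 7 (λ t u d a s b e → (t :* (u :* d)) :* a :+ s :* (b :* (e :* t)) := t :* ((u :* a) :* d :+ (s :* b) :* e)) refl _ _ _ _ _ _ _ ⟩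
      tₖ * ((tᵢ * a i) * δ i k + (sᵢ * b (lookup σ i)) * δ (lookup σ i) (lookup τ k))
        ≈⟨ *-congˡ (+-congʳ (*-congˡ (reflexive (≡.cong ⟦_⟧ (≡.sym (≟-inj (lookup τ) (distinct-elim τ hτ) i k)))))) ⟩
      tₖ * rows (signed t) τ b σ s i (lookup τ k) ∎
      where
      P = signedPerm s σ
      S = signedPerm t τ
      sᵢ = sgn Q (lookup s i)
      tᵢ = sgn Q (lookup t i)
      tₖ = sgn Q (lookup t k)
      sign-square : δ i k ≈ tₖ * (tᵢ * δ i k)
      sign-square with i ≟ᶠ k
      ... | yes ≡.refl = sym (trans (*-congˡ (*-identityʳ _)) (sgn² (lookup t i)))
      ... | no _       = solve 2 (λ t u → :0 := t :* (u :* :0)) refl tₖ tᵢ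

    -- In M Mᵀ each column sign occurs twice and cancels, and relabelling the columns by τ merely
    -- permutes the summation index.
    charDet-gram : ∀ s t (τ σ : Vec (Fin d) d) → distinct τ ≡ true →
      charDet (signedPerm s σ) (signedPerm t τ) ≈ Det (gram x (λ _ → 1#) (rows (signed t) τ b σ s))
    charDet-gram s t τ σ hτ = trans (reflexive (≡.sym (Det≡det _))) (det-cong λ i j → +-congˡ (-‿cong (begin
      Σᶠ Q (λ k → M i k * M j k)
        ≈⟨ reflexive (Σᶠ≡∑ (λ k → M i k * M j k)) ⟩
      ∑ (λ k → M i k * M j k)
        ≈⟨ ∑-cong (λ k → trans (*-cong (sumMat-rows s t τ σ hτ i k) (sumMat-rows s t τ σ hτ j k))
             (trans (solve 3 (λ t p q → (t :* p) :* (t :* q) := (t :* t) :* (p :* q)) refl _ _ _) (*-congʳ (sgn² (lookup t k))))) ⟩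
      ∑ (λ k → 1# * (R i (lookup τ k) * R j (lookup τ k)))
        ≈⟨ ∑-distinct (λ l → 1# * (R i l * R j l)) τ hτ ⟩
      ∑ (λ l → 1# * (R i l * R j l)) ∎)))
      where
      M = sumMat (signedPerm s σ) (signedPerm t τ)
      R = rows (signed t) τ b σ s

    A B : Fin d → Carrier
    A i = a i * a i
    B i = b i * b i

    𝟙 : Fin d → Carrier
    𝟙 _ = 1#

    -- The signs `t` enter only through the squares of `signed t`, so the result is the same for all
    -- of them.
    ∑ⱽ-charDet : ∀ t (τ σ : Vec (Fin d) d) → distinct τ ≡ true → distinct σ ≡ true →
      ∑ⱽ (λ s → charDet (signedPerm s σ) (signedPerm t τ)) ≈ pow (ι 2) d * matchings x A B 𝟙 τ σ
    ∑ⱽ-charDet t τ σ hτ hσ = trans (∑ⱽ-cong λ s → charDet-gram s t τ σ hτ)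
      (trans (∑ⱽ-det-gram x 𝟙 (signed t) b τ σ hτ hσ)
      (*-congˡ (∑ᶜ-cong λ f → *-congʳ (coef-cong x f λ i → trans
        (solve 2 (λ t a → (t :* a) :* (t :* a) := (t :* t) :* (a :* a)) refl _ _)
        (trans (*-congʳ (sgn² (lookup t i))) (*-identityˡ _))))))

    -- For fixed disjoint U and V of sizes i and j: the number of pairs (τ, σ) for which σ(V) is a
    -- prescribed set and τ(U) is disjoint from it.
    count : ℕ → ℕ → ℕ
    count i j = (i ! ℕ.* (d ∸ i) !) ℕ.* (((d ∸ j) C i) ℕ.* (j ! ℕ.* (d ∸ j) !))

    ∑ᴰ-matchings : ∑ᴰ (λ σ → ∑ᴰ λ τ → matchings x A B 𝟙 τ σ) ≈
      ∑≤ d (λ i → esym i A * distribute x (λ i j → ι (count i j) * esym j B) i (d ∸ i))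
    ∑ᴰ-matchings = begin
      ∑ᴰ (λ σ → ∑ᴰ λ τ → ∑ᶜ λ f → coef x A f * place B 𝟙 f τ σ)
        ≈⟨ ∑ᴰ-cong (λ σ → trans (∑ᴰ-∑ᶜ (λ f τ → coef x A f * place B 𝟙 f τ σ)) (∑ᶜ-cong λ f → ∑ᴰ-*ˡ _ _)) ⟩
      ∑ᴰ (λ σ → ∑ᶜ λ f → coef x A f * ∑ᴰ λ τ → place B 𝟙 f τ σ)
        ≈⟨ trans (∑ᴰ-∑ᶜ (λ f σ → coef x A f * ∑ᴰ λ τ → place B 𝟙 f τ σ)) (∑ᶜ-cong λ f → ∑ᴰ-*ˡ _ _) ⟩
      ∑ᶜ (λ f → coef x A f * ∑ᴰ λ σ → ∑ᴰ λ τ → place B 𝟙 f τ σ)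
        ≈⟨ ∑ᶜ-cong (λ f → *-congˡ (trans (∑ᴰ-place B f) (*-congʳ (reflexive (≡.cong ι
             (≡.cong₂ (λ m n → (#true (τ-rows f) ! ℕ.* m !) ℕ.* ((n C #true (τ-rows f)) ℕ.* (#true (σ-rows f) ! ℕ.* n !))) (#false-∸ (τ-rows f)) (#false-∸ (σ-rows f)))))))) ⟩
      ∑ᶜ (λ f → coef x A f * (ι (count (#true (τ-rows f)) (#true (σ-rows f))) * esym (#true (σ-rows f)) B))
        ≈⟨ ∑ᶜ-coef x A (λ i j → ι (count i j) * esym j B) ⟩
      ∑≤ d (λ i → esym i A * distribute x (λ i j → ι (count i j) * esym j B) i (d ∸ i)) ∎
      where
      #false-∸ : ∀ p → #false p ≡ d ∸ #true {d} p
      #false-∸ p = ≡.sym (≡.trans (≡.cong (_∸ #true p) (≡.sym (#true+#false p))) (ℕₚ.m+n∸m≡n (#true p) (#false p)))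

    -- `ρ` takes the place of 1/d!: of the 2^d d! signed permutation matrices, the signs are already
    -- accounted for by the power of 2.
    r ρ : Carrier
    r = recip (List.length (signedPerms Q d))
    ρ = r * pow (ι 2) d

    -- The signs `s` of P are summed innermost, since the matching identity is for fixed τ, σ and t.
    -- What remains is constant in t, so each of the two sign sums contributes a factor 2^d.
    LHS-expand : LHS Q d a b x ≈ (ρ * ρ) * ∑ᴰ (λ σ → ∑ᴰ λ τ → matchings x A B 𝟙 τ σ)
    LHS-expand = begin
      r * ∑ᴸ (signedPerms Q d) (λ P → r * ∑ᴸ (signedPerms Q d) (charDet P))
        ≈⟨ *-congˡ (trans (∑ᴸ-cong (signedPerms Q d) λ P → *-congˡ (∑ᴸ-signedPerms d (charDet P) (charDet-cong λ _ _ → ≡.refl)))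
            (∑ᴸ-signedPerms d (λ P → r * ∑ⱽ λ t → ∑ᴰ λ τ → charDet P (signedPerm t τ))
               (λ h → *-congˡ (∑ⱽ-cong λ t → ∑ᴰ-cong λ τ → charDet-cong h (λ _ _ → ≡.refl))))) ⟩
      r * ∑ⱽ (λ s → ∑ᴰ λ σ → r * ∑ⱽ λ t → ∑ᴰ λ τ → D s σ t τ)
        ≈⟨ *-congˡ (trans (∑ⱽ-cong λ s → ∑ᴰ-*ˡ r _) (∑ⱽ-*ˡ r _)) ⟩
      r * (r * ∑ⱽ (λ s → ∑ᴰ λ σ → ∑ⱽ λ t → ∑ᴰ λ τ → D s σ t τ))
        ≈⟨ *-congˡ (*-congˡ (trans (∑ⱽ-∑ᴰ λ s σ → ∑ⱽ λ t → ∑ᴰ λ τ → D s σ t τ)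
             (∑ᴰ-cong λ σ → trans (∑ⱽ-swap λ s t → ∑ᴰ λ τ → D s σ t τ) (∑ⱽ-cong λ t → ∑ⱽ-∑ᴰ λ s τ → D s σ t τ)))) ⟩
      r * (r * ∑ᴰ (λ σ → ∑ⱽ λ t → ∑ᴰ λ τ → ∑ⱽ λ s → D s σ t τ))
        ≈⟨ *-congˡ (*-congˡ (∑ᴰ-cong′ λ σ hσ → trans
             (∑ⱽ-cong λ t → trans (∑ᴰ-cong′ λ τ hτ → ∑ⱽ-charDet t τ σ hτ hσ) (∑ᴰ-*ˡ _ _)) (∑ⱽ-const d _))) ⟩
      r * (r * ∑ᴰ (λ σ → pow (ι 2) d * (pow (ι 2) d * ∑ᴰ λ τ → matchings x A B 𝟙 τ σ)))
        ≈⟨ *-congˡ (*-congˡ (trans (∑ᴰ-*ˡ _ _) (*-congˡ (∑ᴰ-*ˡ _ _)))) ⟩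
      r * (r * (pow (ι 2) d * (pow (ι 2) d * ∑ᴰ (λ σ → ∑ᴰ λ τ → matchings x A B 𝟙 τ σ))))
        ≈⟨ solve 3 (λ r p m → r :* (r :* (p :* (p :* m))) := ((r :* p) :* (r :* p)) :* m) refl _ _ _ ⟩
      (ρ * ρ) * ∑ᴰ (λ σ → ∑ᴰ λ τ → matchings x A B 𝟙 τ σ) ∎
      where
      D = λ s σ t τ → charDet (signedPerm s σ) (signedPerm t τ)

    -- The list is counted inside the ring, by summing 1 over it, so the machinery for permutation
    -- sums applies.
    ι-length : ι (List.length (signedPerms Q d)) ≈ pow (ι 2) d * ι (d !)
    ι-length = begin
      ι (List.length (signedPerms Q d))               ≈⟨ sym (∑ᴸ-1 (signedPerms Q d)) ⟩
      ∑ᴸ (signedPerms Q d) (λ _ → 1#)                 ≈⟨ ∑ᴸ-signedPerms d (λ _ → 1#) (λ _ → refl) ⟩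
      ∑ⱽ {d} {2} (λ s → ∑ᴰ {d} {d} λ σ → 1#)          ≈⟨ ∑ⱽ-cong (λ s → ∑ᴰ-const d) ⟩
      ∑ⱽ {d} {2} (λ s → ι (d !))                      ≈⟨ ∑ⱽ-const d _ ⟩
      pow (ι 2) d * ι (d !)                           ∎

    -- If the list were empty, ι (2 ^ d * d !) would vanish, and the ring would be trivial.
    ρ-inverse : ρ * ι (d !) ≈ 1#
    ρ-inverse with List.length (signedPerms Q d) ℕ.≟ 0
    ... | no L≢0 = trans (*-assoc _ _ _) (trans (*-congˡ (sym ι-length)) (trans (*-comm _ _) (recip-inverse _ L≢0)))
    ... | yes L≡0 = begin
      ρ * ι (d !)          ≈⟨ sym (*-identityˡ _) ⟩
      1# * (ρ * ι (d !))   ≈⟨ *-congʳ trivial ⟩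
      0# * (ρ * ι (d !))   ≈⟨ zeroˡ _ ⟩
      0#                   ≈⟨ sym trivial ⟩
      1#                   ∎
      where
      w = 2 ℕ.^ d ℕ.* d !
      ι-^ : ∀ n → ι (2 ℕ.^ n) ≈ pow (ι 2) n
      ι-^ zero    = ι-1
      ι-^ (suc n) = trans (ι-* 2 (2 ℕ.^ n)) (*-congˡ (ι-^ n))
      w≢0 : w ≢ 0
      w≢0 = ℕ.≢-nonZero⁻¹ w {{ℕₚ.m*n≢0 (2 ℕ.^ d) (d !) {{ℕₚ.m^n≢0 2 d}} {{d !≢0}}}}
      trivial : 1# ≈ 0#
      trivial = begin
        1#                                          ≈⟨ sym (recip-inverse w w≢0) ⟩
        ι w * recip w                               ≈⟨ *-congʳ (trans (ι-* (2 ℕ.^ d) (d !)) (trans (*-congʳ (ι-^ d)) (sym ι-length))) ⟩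
        ι (List.length (signedPerms Q d)) * recip w ≈⟨ *-congʳ (reflexive (≡.cong ι L≡0)) ⟩
        0# * recip w                                ≈⟨ zeroˡ _ ⟩
        0#                                          ∎

    -- Cancels the common factor: w K / (K d!) = w / d!, with `ρ` for 1/d!.
    scaled : ∀ {m n w K} → m ≡ w ℕ.* K → n ≡ K ℕ.* d ! → n ≢ 0 → ι m * recip n ≈ ρ * ι w
    scaled {w = w} {K} ≡.refl ≡.refl n≢0 = begin
      ι (w ℕ.* K) * recip n                       ≈⟨ *-congʳ (ι-* w K) ⟩
      (ι w * ι K) * recip n                       ≈⟨ sym (trans (*-congˡ ρ-inverse) (*-identityʳ _)) ⟩
      ((ι w * ι K) * recip n) * (ρ * ι (d !))     ≈⟨ solve 5 (λ w k n r f → ((w :* k) :* n) :* (r :* f) := (r :* w) :* ((k :* f) :* n)) refl _ _ _ _ _ ⟩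
      (ρ * ι w) * ((ι K * ι (d !)) * recip n)     ≈⟨ *-congˡ (trans (*-congʳ (sym (ι-* K (d !)))) (recip-inverse n n≢0)) ⟩
      (ρ * ι w) * 1#                              ≈⟨ *-identityʳ _ ⟩
      ρ * ι w                                     ∎
      where n = K ℕ.* d !

    coeff-count : ∀ {k i} → k ≤ d → i ≤ k →
      coeff Q d i (k ∸ i) k ≈ (ρ * ρ) * ι (((d ∸ i) C (k ∸ i)) ℕ.* count i (k ∸ i))
    coeff-count {k} {i} k≤d i≤k = begin
      (ι m * recip n) * (ι m * recip n)
        -- The two equal factors are rewritten differently: (d-j)! = C(d-j, i) i! (d-k)! in the
        -- first, (d-i)! = C(d-i, j) j! (d-k)! in the second. Their product then contains both
        -- binomial coefficients of the count.
        ≈⟨ *-cong (scaled {w = u ℕ.* (d ∸ i) !} {K} eq₁ ≡.refl n≢0) (scaled {w = v ℕ.* (d ∸ j) !} {K} eq₂ ≡.refl n≢0) ⟩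
      (ρ * ι (u ℕ.* (d ∸ i) !)) * (ρ * ι (v ℕ.* (d ∸ j) !))
        ≈⟨ solve 3 (λ r p q → (r :* p) :* (r :* q) := (r :* r) :* (p :* q)) refl _ _ _ ⟩
      (ρ * ρ) * (ι (u ℕ.* (d ∸ i) !) * ι (v ℕ.* (d ∸ j) !))
        ≈⟨ *-congˡ (trans (sym (ι-* (u ℕ.* (d ∸ i) !) _)) (reflexive (≡.cong ι (regroup ((d ∸ j) C i) (i !) ((d ∸ i) !) ((d ∸ i) C j) (j !) ((d ∸ j) !))))) ⟩
      (ρ * ρ) * ι (((d ∸ i) C j) ℕ.* count i j) ∎
      where
      j = k ∸ i
      K = (d ∸ k) !
      m = (d ∸ i) ! ℕ.* (d ∸ j) !
      n = K ℕ.* d !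
      u = ((d ∸ j) C i) ℕ.* i !
      v = ((d ∸ i) C j) ℕ.* j !
      n≢0 : n ≢ 0
      n≢0 = ℕ.≢-nonZero⁻¹ n {{ℕₚ.m*n≢0 K (d !) {{(d ∸ k) !≢0}} {{d !≢0}}}}
      regroup : ∀ c p q e f g → c ℕ.* p ℕ.* q ℕ.* (e ℕ.* f ℕ.* g) ≡ e ℕ.* (p ℕ.* q ℕ.* (c ℕ.* (f ℕ.* g)))
      regroup = ℕ-Solver.solve-∀
      i+j : i ℕ.+ j ≡ k
      i+j = ℕₚ.m+[n∸m]≡n i≤k
      uK : u ℕ.* K ≡ (d ∸ j) !
      uK = ≡.trans (ℕₚ.*-assoc ((d ∸ j) C i) (i !) K) (≡.trans
        (≡.cong (λ l → ((d ∸ j) C i) ℕ.* (i ! ℕ.* l !)) (≡.sym (≡.trans (ℕₚ.∸-+-assoc d j i) (≡.cong (d ∸_) (≡.trans (ℕₚ.+-comm j i) i+j)))))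
        (nCk*k!*[n∸k]! (ℕₚ.m+n≤o⇒m≤o∸n i (≡.subst (_≤ d) (≡.sym i+j) k≤d))))
      vK : v ℕ.* K ≡ (d ∸ i) !
      vK = ≡.trans (ℕₚ.*-assoc ((d ∸ i) C j) (j !) K) (≡.trans
        (≡.cong (λ l → ((d ∸ i) C j) ℕ.* (j ! ℕ.* l !)) (≡.sym (≡.trans (ℕₚ.∸-+-assoc d i j) (≡.cong (d ∸_) i+j))))
        (nCk*k!*[n∸k]! (ℕₚ.∸-monoˡ-≤ i k≤d)))
      swap₁ : ∀ p q e → p ℕ.* (q ℕ.* e) ≡ q ℕ.* p ℕ.* e
      swap₁ = ℕ-Solver.solve-∀
      swap₂ : ∀ p q e → p ℕ.* e ℕ.* q ≡ p ℕ.* q ℕ.* e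
      swap₂ = ℕ-Solver.solve-∀
      eq₁ : m ≡ u ℕ.* (d ∸ i) ! ℕ.* K
      eq₁ = ≡.trans (≡.cong ((d ∸ i) ! ℕ.*_) (≡.sym uK)) (swap₁ ((d ∸ i) !) u K)
      eq₂ : m ≡ v ℕ.* (d ∸ j) ! ℕ.* K
      eq₂ = ≡.trans (≡.cong (ℕ._* (d ∸ j) !) (≡.sym vK)) (swap₂ v ((d ∸ j) !) K)

    expansion : LHS Q d a b x ≈ RHS Q d a b x
    expansion = begin
      LHS Q d a b x
        ≈⟨ trans LHS-expand (*-congˡ ∑ᴰ-matchings) ⟩
      (ρ * ρ) * ∑≤ d (λ i → esym i A * distribute x G i (d ∸ i))
        ≈⟨ *-congˡ (trans (∑≤-cong d λ i _ → sym (∑≤-*ˡ (d ∸ i) (esym i A) _)) (∑≤-triangle d F)) ⟩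
      (ρ * ρ) * ∑≤ d (λ k → ∑≤ k λ i → F i (k ∸ i))
        ≈⟨ sym (trans (∑≤-cong d λ k _ → ∑≤-*ˡ k (ρ * ρ) _) (∑≤-*ˡ d (ρ * ρ) _)) ⟩
      ∑≤ d (λ k → ∑≤ k λ i → (ρ * ρ) * F i (k ∸ i))
        ≈⟨ ∑≤-cong d (λ k k≤d → trans (∑≤-cong k λ i i≤k → term k≤d i≤k) (trans (∑≤-*ˡ k _ _) (*-congˡ (∑≤-*ˡ k _ _)))) ⟩
      ∑≤ d (λ k → pow x (d ∸ k) * (pow (- 1#) k * ∑≤ k λ i → coeff Q d i (k ∸ i) k * (eA i * eB (k ∸ i))))
        ≈⟨ ∑≤-cong d (λ k _ → *-congˡ (*-congˡ (reflexive (≡.sym (Σ≤≡∑≤ k _))))) ⟩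
      ∑≤ d (λ k → pow x (d ∸ k) * (pow (- 1#) k * Σ≤ Q k λ i → coeff Q d i (k ∸ i) k * (eA i * eB (k ∸ i))))
        ≈⟨ reflexive (≡.sym (Σ≤≡∑≤ d _)) ⟩
      RHS Q d a b x ∎
      where
      G : ℕ → ℕ → Carrier
      G i j = ι (count i j) * esym j B
      F : ℕ → ℕ → Carrier
      F i j = esym i A * (ι ((d ∸ i) C j) * (pow x (d ∸ i ∸ j) * (pow (- 1#) (i ℕ.+ j) * G i j)))
      eA eB : ℕ → Carrier
      eA i = e Q i (_⊗_ Q (diag Q a) (_ᵀ Q (diag Q a)))
      eB j = e Q j (_⊗_ Q (diag Q b) (_ᵀ Q (diag Q b)))
      term : ∀ {k i} → k ≤ d → i ≤ k →
        (ρ * ρ) * F i (k ∸ i) ≈ pow x (d ∸ k) * (pow (- 1#) k * (coeff Q d i (k ∸ i) k * (eA i * eB (k ∸ i))))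
      term {k} {i} k≤d i≤k = begin
        (ρ * ρ) * F i (k ∸ i)
          ≈⟨ *-congˡ (*-congˡ (*-congˡ (*-cong
               (reflexive (≡.cong (pow x) (≡.trans (ℕₚ.∸-+-assoc d i (k ∸ i)) (≡.cong (d ∸_) (ℕₚ.m+[n∸m]≡n i≤k)))))
               (*-congʳ (reflexive (≡.cong (pow (- 1#)) (ℕₚ.m+[n∸m]≡n i≤k))))))) ⟩
        (ρ * ρ) * (esym i A * (ι ((d ∸ i) C (k ∸ i)) * (pow x (d ∸ k) * (pow (- 1#) k * (ι (count i (k ∸ i)) * esym (k ∸ i) B)))))
          ≈⟨ solve 7 (λ r p c x s n q → r :* (p :* (c :* (x :* (s :* (n :* q))))) := x :* (s :* ((r :* (c :* n)) :* (p :* q)))) refl _ _ _ _ _ _ _ ⟩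
        pow x (d ∸ k) * (pow (- 1#) k * (((ρ * ρ) * (ι ((d ∸ i) C (k ∸ i)) * ι (count i (k ∸ i)))) * (esym i A * esym (k ∸ i) B)))
          ≈⟨ *-congˡ (*-congˡ (*-cong (trans (*-congˡ (sym (ι-* ((d ∸ i) C (k ∸ i)) _))) (sym (coeff-count k≤d i≤k)))
               (sym (*-cong (e-diag i a) (e-diag (k ∸ i) b))))) ⟩
        pow x (d ∸ k) * (pow (- 1#) k * (coeff Q d i (k ∸ i) k * (eA i * eB (k ∸ i)))) ∎

theorem2p5 : ∀ {c ℓ} (Q : QAlgebra c ℓ) (d : ℕ) (a b : Fin d → QAlgebra.Carrier Q) (x : QAlgebra.Carrier Q) →
    QAlgebra._≈_ Q (LHS Q d a b x) (RHS Q d a b x)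
theorem2p5 Q d a b x = Expansion.expansion Q a b x
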